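{- For all $\delta,\delta'\in\{\mathbf{CInd},\mathbf{T}\}$ we have $[\tau(\delta)\mathbf{Txt}\mathbf{G}\delta'\mathbf{Ex}_C]_{\mathbf{REC}} = [\tau(\delta)\mathcal{R}\mathbf{Txt}\mathbf{Psd}\delta'\mathbf{Ex}_C]_{\mathbf{REC}}$.
   Context: Fix an acceptable numbering $(\varphi_e)_{e\in\mathbb{N}}$ of all partial computable functions. A number $e$ is a $C$-index if $\varphi_e$ is total with values in $\{0,1\}$; then $C_e=\{x:\varphi_e(x)=1\}$. $\mathbf{REC}$ is the collection of recursive subsets of $\mathbb{N}$; $\mathcal{P}$ and $\mathcal{R}$ are the partial computable and total computable functions. Fix a pause symbol $\#$. A text is a total function $T:\mathbb{N}\to\mathbb{N}\cup\{\#\}$, $\mathrm{content}(T)=\mathrm{range}(T)\setminus\{\#\}$, $T$ is a text for $L$ if $\mathrm{content}(T)=L$, $T[n]=(T(0),\dots,T(n-1))$, and content of finite sequences is defined likewise. A learner is some $h\in\mathcal{P}$ (finite sequences/sets coded as numbers). Hypothesis sequences: full-information $\mathbf{G}(h,T)(i)=h(T[i])$; partially set-driven $\mathbf{Psd}(h,T)(i)=h(\mathrm{content}(T[i]),i)$. Restrictions on a hypothesis sequence $p$ and text $T$: $\mathbf{Ex}_C$: there is $n_0$ with $p(n)=p(n_0)$ for all $n\ge n_0$ and $p(n_0)$ a $C$-index with $C_{p(n_0)}=\mathrm{content}(T)$; $\mathbf{CInd}$: for all $i$, $p(i)$ is a $C$-index; $\mathbf{T}$: always true. Juxtaposition of restrictions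 means conjunction. For a set of admissible learners $\mathcal{C}\in\{\mathcal{P},\mathcal{R}\}$ (omitted means $\mathcal{P}$), a learner $h\in\mathcal{C}$ $\tau(\alpha)\mathcal{C}\mathbf{Txt}\beta\delta$-learns $L$ iff $\alpha(\beta(h,T),T)$ holds for every text $T$ whatsoever and $\delta(\beta(h,T),T)$ holds for every text $T$ for $L$ (omitting $\tau(\alpha)$ means $\alpha=\mathbf{T}$). $[\tau(\alpha)\mathcal{C}\mathbf{Txt}\beta\delta]_{\mathbf{REC}}$ is the set of all classes $\mathcal{L}\subseteq\mathbf{REC}$ for which some $h\in\mathcal{C}$ learns every $L\in\mathcal{L}$ in this sense. -}

module Defs where

open import Level using (0ℓ)
open import Data.Nat using (ℕ; zero; suc; _+_; _*_; _≤_; _<_; _≡ᵇ_; NonZero)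
open import Data.Nat.DivMod using (_/_; _%_; _mod_)
open import Data.Fin using (Fin)
open import Data.Vec using (Vec; []; _∷_; lookup)
open import Data.List using (List; []; _∷_; foldr; applyUpTo; catMaybes)
open import Data.Maybe using (Maybe; just; nothing)
open import Data.Bool using (Bool; true; false; if_then_else_)
open import Data.Product using (Σ; ∃; _×_; _,_; proj₁; proj₂)
open import Data.Sum using (_⊎_)
open import Data.Unit using (⊤)
open import Function.Bundles using (_⇔_)
open import Relation.Unary using (Pred)
open import Relation.Binary.PropositionalEquality using (_≡_)

data PR : ℕ → Set where
  zer  : ∀ {n} → PR n
  succ : PR 1
  proj : ∀ {n} → Fin n → PR n
  comp : ∀ {m n} → PR m → Vec (PR n) m → PR n
  prec : ∀ {n} → PR n → PR (suc (suc n)) → PR (suc n)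
  mu   : ∀ {n} → PR (suc n) → PR n

mutual
  data _⊢_⇓_ : ∀ {n} → PR n → Vec ℕ n → ℕ → Set where
    ev-zer  : ∀ {n} {xs : Vec ℕ n} → zer ⊢ xs ⇓ 0
    ev-succ : ∀ {x} → succ ⊢ (x ∷ []) ⇓ suc x
    ev-proj : ∀ {n} {i : Fin n} {xs} → proj i ⊢ xs ⇓ lookup xs i
    ev-comp : ∀ {m n} {f : PR m} {gs : Vec (PR n) m} {xs ys z} →
              gs ⊢* xs ⇓ ys → f ⊢ ys ⇓ z → comp f gs ⊢ xs ⇓ z
    ev-prec0 : ∀ {n} {f : PR n} {g} {xs z} →
               f ⊢ xs ⇓ z → prec f g ⊢ (0 ∷ xs) ⇓ z
    ev-precS : ∀ {n} {f : PR n} {g} {k xs y z} →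
               prec f g ⊢ (k ∷ xs) ⇓ y → g ⊢ (k ∷ y ∷ xs) ⇓ z →
               prec f g ⊢ (suc k ∷ xs) ⇓ z
    ev-mu   : ∀ {n} {f : PR (suc n)} {xs k} →
              f ⊢ (k ∷ xs) ⇓ 0 →
              (∀ j → j < k → Σ ℕ λ m → f ⊢ (j ∷ xs) ⇓ suc m) →
              mu f ⊢ xs ⇓ k

  data _⊢*_⇓_ : ∀ {m n} → Vec (PR n) m → Vec ℕ n → Vec ℕ m → Set where
    ev-[] : ∀ {n} {xs : Vec ℕ n} → [] ⊢* xs ⇓ []
    ev-∷  : ∀ {m n} {g} {gs : Vec (PR n) m} {xs y ys} →
            g ⊢ xs ⇓ y → gs ⊢* xs ⇓ ys → (g ∷ gs) ⊢* xs ⇓ (y ∷ ys)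

-- Cantor pairing and its inverse (enumeration order along diagonals).

tri : ℕ → ℕ
tri zero    = 0
tri (suc n) = suc n + tri n

pair : ℕ → ℕ → ℕ
pair x y = tri (x + y) + y

unpair : ℕ → ℕ × ℕ
unpair zero = 0 , 0
unpair (suc n) with unpair n
... | zero  , y = suc y , 0
... | suc x , y = x , suc y

-- Gödel numbering of programs (an effective, surjective decoding; hence
-- the induced numbering φ is acceptable).  The fuel argument only ensures
-- structural termination; fuel (suc e) always suffices for the number e.

mutual
  dec : ℕ → (n : ℕ) → ℕ → PR n
  dec zero    n e = zer
  dec (suc f) n e = decT f n (e % 6) (e / 6)

  decT : ℕ → (n : ℕ) → ℕ → ℕ → PR n
  decT f n       0 r = zer
  decT f 1       1 r = succ
  decT f _       1 r = zer
  decT f zero    2 r = zer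
  decT f (suc n) 2 r = proj (r mod (suc n))
  decT f n       3 r = comp (dec f (proj₁ (unpair (proj₁ (unpair r))))
                                   (proj₂ (unpair (proj₁ (unpair r)))))
                            (decVec f n (proj₁ (unpair (proj₁ (unpair r))))
                                        (proj₂ (unpair r)))
  decT f zero    4 r = zer
  decT f (suc n) 4 r = prec (dec f n (proj₁ (unpair r)))
                            (dec f (suc (suc n)) (proj₂ (unpair r)))
  decT f n       _ r = mu (dec f (suc n) r)

  decVec : ℕ → (n m : ℕ) → ℕ → Vec (PR n) m
  decVec f n zero    b = []
  decVec f n (suc m) b = dec f n (proj₁ (unpair b)) ∷ decVec f n m (proj₂ (unpair b))

program : ℕ → PR 1
program e = dec (suc e) 1 e

φ_⟨_⟩⇓_ : ℕ → ℕ → ℕ → Set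
φ e ⟨ x ⟩⇓ y = program e ⊢ (x ∷ []) ⇓ y

Total : ℕ → Set
Total e = ∀ x → Σ ℕ λ y → φ e ⟨ x ⟩⇓ y

CIndex : ℕ → Set
CIndex e = ∀ x → φ e ⟨ x ⟩⇓ 0 ⊎ φ e ⟨ x ⟩⇓ 1

C : ℕ → Pred ℕ 0ℓ
C e x = φ e ⟨ x ⟩⇓ 1

REC : Pred ℕ 0ℓ → Set
REC L = Σ ℕ λ e → CIndex e × (∀ x → C e x ⇔ L x)

-- Texts (nothing = pause symbol #), content, coding of finite sequences/sets

Text : Set
Text = ℕ → Maybe ℕ

content : Text → Pred ℕ 0ℓ
content T x = Σ ℕ λ i → T i ≡ just x

TextFor : Text → Pred ℕ 0ℓ → Set
TextFor T L = ∀ x → content T x ⇔ L x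

prefix : Text → ℕ → List (Maybe ℕ)
prefix T n = applyUpTo T n

encSym : Maybe ℕ → ℕ
encSym nothing  = 0
encSym (just x) = suc x

seqCode : List (Maybe ℕ) → ℕ
seqCode []      = 0
seqCode (a ∷ σ) = suc (pair (encSym a) (seqCode σ))

-- canonical code of a finite set: sum of 2^x over its elements
testBit : ℕ → ℕ → Bool
testBit c zero    = c % 2 ≡ᵇ 1
testBit c (suc x) = testBit (c / 2) x

pow2 : ℕ → ℕ
pow2 zero    = 1
pow2 (suc n) = 2 * pow2 n

insertSet : ℕ → ℕ → ℕ
insertSet x c = if testBit c x then c else c + pow2 x

setCode : List ℕ → ℕ
setCode = foldr insertSet 0

contentCode : Text → ℕ → ℕ
contentCode T n = setCode (catMaybes (prefix T n))

-- Hypothesis sequences (partial, given by their graphs)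

HypSeq : Set₁
HypSeq = ℕ → ℕ → Set

G : ℕ → Text → HypSeq
G h T i y = φ h ⟨ seqCode (prefix T i) ⟩⇓ y

Psd : ℕ → Text → HypSeq
Psd h T i y = φ h ⟨ pair (contentCode T i) i ⟩⇓ y

ExC : HypSeq → Text → Set
ExC p T = Σ ℕ λ n₀ → Σ ℕ λ c →
  (∀ n → n₀ ≤ n → p n c) × CIndex c × (∀ x → C c x ⇔ content T x)

data Restr : Set where
  CInd Tr : Restr

⟦_⟧ : Restr → HypSeq → Text → Set
⟦ CInd ⟧ p T = ∀ i → Σ ℕ λ c → p i c × CIndex c
⟦ Tr   ⟧ p T = ⊤

-- [τ(δ) Txt G δ' Ex_C]_REC membership (learner h ∈ 𝒫 given by an index)
LearnG : Restr → Restr → Pred (Pred ℕ 0ℓ) 0ℓ → Set₁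
LearnG δ δ′ 𝓛 = Σ ℕ λ h →
  (∀ T → ⟦ δ ⟧ (G h T) T) ×
  (∀ L → 𝓛 L → ∀ T → TextFor T L → ⟦ δ′ ⟧ (G h T) T × ExC (G h T) T)

LearnRPsd : Restr → Restr → Pred (Pred ℕ 0ℓ) 0ℓ → Set₁
LearnRPsd δ δ′ 𝓛 = Σ ℕ λ h → Total h ×
  (∀ T → ⟦ δ ⟧ (Psd h T) T) ×
  (∀ L → 𝓛 L → ∀ T → TextFor T L → ⟦ δ′ ⟧ (Psd h T) T × ExC (Psd h T) T)

{-# OPTIONS --safe #-}
module Submission where

-- From Psd to G one precomposes the learner with the computation of content and
-- length from the sequence.  Conversely, h is first made total: g answers with
-- h on the longest prefix on which h is seen to halt in as many steps as the
-- input is long.  The new learner, given a finite set D and a time t, picks the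
-- least finite sequence σ on which g is stable up to time t along σ followed by
-- a fixed enumeration of D.  Its hypothesis v need not converge syntactically,
-- but eventually always is a C-index of the language L.  Since v decides L, the
-- initial segment on which D agrees with L can be recognised, and the learner
-- answers with g on the corresponding prefix of the canonical text of L, where
-- g converges.
--
-- The usual locking sequence argument is classical.  Here one shows instead
-- that either g is eventually stable along the canonical enumerations of the
-- sets D, or the limited principle of omniscience holds (Ishihara's tricks,
-- applied to the convergence points of g on suitable texts), in which case a
-- locking sequence can be constructed.

open import Defs
open import Level using (0ℓ)
open import Data.Bool using (Bool; true; false; if_then_else_; _∧_; _∨_; not)
open import Data.Bool.Properties using (T-≡; ∨-zeroʳ)
open import Data.Empty using (⊥; ⊥-elim)
open import Data.Fin using (Fin; zero; suc; toℕ)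
open import Data.Fin.Properties using (toℕ-injective; toℕ-fromℕ<; toℕ<n)
open import Data.List using (List; []; _∷_; catMaybes; length)
open import Data.List.Properties using (length-applyUpTo)
open import Data.Maybe using (Maybe; just; nothing; _<∣>_)
open import Data.Nat using (ℕ; zero; suc; pred; _+_; _*_; _∸_; _⊔_; _≤_; _<_; z≤n; s≤s; _≡ᵇ_; _<ᵇ_)
open import Data.Nat.Divisibility using (n∣m*n)
open import Data.Nat.DivMod
open import Data.Nat.Properties
open import Data.Product using (Σ; _×_; _,_; proj₁; proj₂)
open import Data.Sum using (_⊎_; inj₁; inj₂)
open import Data.Unit using (tt)
open import Data.Vec using (Vec; []; _∷_; lookup; head; tail; tabulate)
open import Data.Vec.Properties using (tabulate∘lookup)
open import Function using (_∘_; Equivalence; mk⇔)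
open import Function.Bundles using (_⇔_)
open import Relation.Binary.Definitions using (tri<; tri≈; tri>)
open import Relation.Binary.PropositionalEquality
open import Relation.Nullary using (yes; no; ¬_)
open import Relation.Unary using (Pred)

open Equivalence using (to; from)

-- Computable functions

-- Two demands shape the learner. Under `CInd` a hypothesis is safe when it is a value of `h` on a
-- sequence with content inside D, since such a sequence extends to a text with the content of the
-- given one. This is why candidates erase everything outside D, and why the default of the total
-- learner is 0, an index of the empty set.
--
-- The guess v cannot itself be the hypothesis: whether a candidate looks stable is not monotone in
-- D and t, so v may switch forever between indices of L. What confines it is that every candidate,
-- filtered by L, is a text for L. Once t has passed the convergence point of g on that text,
-- looking stable up to t forces the limit there. A single eventually stable candidate bounds the
-- search, so finitely many correct indices remain.
--
-- The omniscience alternative arises because g must converge on every text for L. If there are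
-- arbitrarily late D on which g leaves its limit, any binary sequence can be built into a text:
-- follow the canonical text and insert such a deviation once the sequence turns true. The
-- convergence point on that text bounds where a first true value can lie.

mutual
  ⇓-deterministic : ∀ {n} {p : PR n} {xs y z} → p ⊢ xs ⇓ y → p ⊢ xs ⇓ z → y ≡ z
  ⇓-deterministic ev-zer ev-zer = refl
  ⇓-deterministic ev-succ ev-succ = refl
  ⇓-deterministic ev-proj ev-proj = refl
  ⇓-deterministic (ev-comp gs f) (ev-comp gs′ f′) with ⇓*-deterministic gs gs′
  ... | refl = ⇓-deterministic f f′
  ⇓-deterministic (ev-prec0 d) (ev-prec0 d′) = ⇓-deterministic d d′
  ⇓-deterministic (ev-precS d e) (ev-precS d′ e′) with ⇓-deterministic d d′
  ... | refl = ⇓-deterministic e e′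
  ⇓-deterministic {y = k} {k′} (ev-mu z s) (ev-mu z′ s′) with <-cmp k k′
  ... | tri≈ _ eq _ = eq
  ... | tri< lt _ _ with s′ k lt
  ...   | _ , d with ⇓-deterministic z d
  ...     | ()
  ⇓-deterministic {y = k} {k′} (ev-mu z s) (ev-mu z′ s′) | tri> _ _ gt with s k′ gt
  ...   | _ , d with ⇓-deterministic d z′
  ...     | ()

  ⇓*-deterministic : ∀ {m n} {ps : Vec (PR n) m} {xs ys zs} →
    ps ⊢* xs ⇓ ys → ps ⊢* xs ⇓ zs → ys ≡ zs
  ⇓*-deterministic ev-[] ev-[] = refl
  ⇓*-deterministic (ev-∷ d ds) (ev-∷ e es) = cong₂ _∷_ (⇓-deterministic d e) (⇓*-deterministic ds es)

-- The function is in the type and the program is its realizer, so computability proofs repeat the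
-- shape of the definitions.
record Computable {n} (f : Vec ℕ n → ℕ) : Set where
  constructor _computes_
  field
    code : PR n
    eval : ∀ ρ → code ⊢ ρ ⇓ f ρ

open Computable public

module _ where

  private variable
    n : ℕ
    a b c d : Vec ℕ n → ℕ

  -- Quantifying over all instances `a` in all contexts builds in closure under composition and use
  -- inside loop bodies.
  Computable₁ : (ℕ → ℕ) → Set
  Computable₁ f = ∀ {n} {a : Vec ℕ n → ℕ} → Computable a → Computable (λ ρ → f (a ρ))

  Computable₂ : (ℕ → ℕ → ℕ) → Set
  Computable₂ f = ∀ {n} {a b : Vec ℕ n → ℕ} → Computable a → Computable b →
    Computable (λ ρ → f (a ρ) (b ρ))

  computable-≗ : (∀ ρ → a ρ ≡ b ρ) → Computable a → Computable b
  computable-≗ eq (p computes ev) = p computes λ ρ → subst (p ⊢ ρ ⇓_) (eq ρ) (ev ρ)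

  projections : ∀ {m} (ι : Fin m → Fin n) → Vec (PR n) m
  projections ι = tabulate (proj ∘ ι)

  projections-⇓ : ∀ {m} (ι : Fin m → Fin n) ρ → projections ι ⊢* ρ ⇓ tabulate (lookup ρ ∘ ι)
  projections-⇓ {m = zero}  ι ρ = ev-[]
  projections-⇓ {m = suc m} ι ρ = ev-∷ ev-proj (projections-⇓ (ι ∘ suc) ρ)

  v₀ : Computable {suc n} head
  v₀ = proj zero computes λ { (x ∷ ρ) → ev-proj }

  wk : Computable a → Computable (λ ρ → a (tail ρ))
  wk {a = a} (p computes ev) = comp p (projections suc) computes λ
    { (x ∷ ρ) → ev-comp (projections-⇓ suc (x ∷ ρ)) (subst (p ⊢_⇓ a ρ) (sym (tabulate∘lookup ρ)) (ev ρ)) }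

  -- In a loop body, position 0 is the counter and position 1 the accumulated value; a predicate of
  -- the counter has to skip the latter.
  wk₁ : {a : Vec ℕ (suc n) → ℕ} → Computable a →
    Computable {suc (suc n)} (λ ρ → a (head ρ ∷ tail (tail ρ)))
  wk₁ {n} {a} (p computes ev) = comp p (proj zero ∷ projections ι) computes λ
    { (k ∷ r ∷ ρ) → ev-comp
        (ev-∷ ev-proj (projections-⇓ ι (k ∷ r ∷ ρ)))
        (subst (λ xs → p ⊢ (k ∷ xs) ⇓ a (k ∷ ρ)) (sym (tabulate∘lookup ρ)) (ev (k ∷ ρ))) }
    where
    ι : Fin n → Fin (suc (suc n))
    ι i = suc (suc i)

  constᶜ : ∀ k → Computable {n} (λ _ → k)
  constᶜ zero    = zer computes λ _ → ev-zer
  constᶜ (suc k) = comp succ (code (constᶜ k) ∷ []) computes λ ρ →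
    ev-comp (ev-∷ (eval (constᶜ k) ρ) ev-[]) ev-succ

  sucᶜ : Computable₁ suc
  sucᶜ (p computes ev) = comp succ (p ∷ []) computes λ ρ → ev-comp (ev-∷ (ev ρ) ev-[]) ev-succ

  natrec : ∀ {A : Set} → A → (ℕ → A → A) → ℕ → A
  natrec z s zero    = z
  natrec z s (suc k) = s k (natrec z s k)

  natrecᶜ : {s : ℕ → ℕ → Vec ℕ n → ℕ} →
    Computable a →
    Computable {suc (suc n)} (λ ρ → s (head ρ) (head (tail ρ)) (tail (tail ρ))) →
    Computable b →
    Computable (λ ρ → natrec (a ρ) (λ k r → s k r ρ) (b ρ))
  natrecᶜ {n = n} {a = a} {b = b} {s = s} (p computes evp) (q computes evq) (r computes evr) =
    comp (prec p q) (r ∷ projections (λ i → i)) computes λ ρ →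
      ev-comp (ev-∷ (evr ρ) (subst (projections (λ i → i) ⊢* ρ ⇓_) (tabulate∘lookup ρ) (projections-⇓ (λ i → i) ρ)))
              (loop ρ (b ρ))
    where
    loop : ∀ ρ k → prec p q ⊢ (k ∷ ρ) ⇓ natrec (a ρ) (λ k r → s k r ρ) k
    loop ρ zero    = ev-prec0 (evp ρ)
    loop ρ (suc k) = ev-precS (loop ρ k) (evq (k ∷ natrec (a ρ) (λ k r → s k r ρ) k ∷ ρ))

  predᶜ : Computable₁ pred
  predᶜ {a = a} ca = computable-≗ (λ ρ → lemma (a ρ)) (natrecᶜ {s = λ k _ _ → k} (constᶜ 0) v₀ ca)
    where
    lemma : ∀ k → natrec 0 (λ k _ → k) k ≡ pred k
    lemma zero    = refl
    lemma (suc k) = refl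

  _+ᶜ_ : Computable₂ _+_
  _+ᶜ_ {a = a} {b} ca cb = computable-≗ (λ ρ → lemma (a ρ) (b ρ))
    (natrecᶜ {s = λ _ r _ → suc r} cb (sucᶜ (wk v₀)) ca)
    where
    lemma : ∀ x y → natrec y (λ _ → suc) x ≡ x + y
    lemma zero    y = refl
    lemma (suc x) y = cong suc (lemma x y)

  _*ᶜ_ : Computable₂ _*_
  _*ᶜ_ {a = a} {b} ca cb = computable-≗ (λ ρ → lemma (a ρ) (b ρ))
    (natrecᶜ {s = λ _ r ρ → b ρ + r} (constᶜ 0) (wk (wk cb) +ᶜ wk v₀) ca)
    where
    lemma : ∀ x y → natrec 0 (λ _ → y +_) x ≡ x * y
    lemma zero    y = refl
    lemma (suc x) y = cong (y +_) (lemma x y)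

  _∸ᶜ_ : Computable₂ _∸_
  _∸ᶜ_ {a = a} {b} ca cb = computable-≗ (λ ρ → lemma (a ρ) (b ρ))
    (natrecᶜ {s = λ _ r _ → pred r} ca (predᶜ (wk v₀)) cb)
    where
    lemma : ∀ x y → natrec x (λ _ → pred) y ≡ x ∸ y
    lemma x zero    = refl
    lemma x (suc y) = trans (cong pred (lemma x y)) (pred[m∸n]≡m∸[1+n] x y)

  bit : Bool → ℕ
  bit false = 0
  bit true  = 1

  Computableᵇ : (Vec ℕ n → Bool) → Set
  Computableᵇ b = Computable (λ ρ → bit (b ρ))

  ifᶜ : ∀ {b : Vec ℕ n → Bool} → Computableᵇ b → Computable c → Computable d →
    Computable (λ ρ → if b ρ then c ρ else d ρ)
  ifᶜ {c = c} {d} {b} cb cc cd = computable-≗ (λ ρ → lemma (b ρ))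
    (natrecᶜ {s = λ _ _ ρ → c ρ} cd (wk (wk cc)) cb)
    where
    lemma : ∀ t {x y} → natrec y (λ _ _ → x) (bit t) ≡ (if t then x else y)
    lemma true  = refl
    lemma false = refl

  ifᵇᶜ : ∀ {b c d : Vec ℕ n → Bool} → Computableᵇ b → Computableᵇ c → Computableᵇ d →
    Computableᵇ (λ ρ → if b ρ then c ρ else d ρ)
  ifᵇᶜ {b = b} cb cc cd = computable-≗ (λ ρ → lemma (b ρ)) (ifᶜ cb cc cd)
    where
    lemma : ∀ t {x y} → (if t then bit x else bit y) ≡ bit (if t then x else y)
    lemma true  = refl
    lemma false = refl

  _∧ᶜ_ : ∀ {b c : Vec ℕ n → Bool} → Computableᵇ b → Computableᵇ c → Computableᵇ (λ ρ → b ρ ∧ c ρ)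
  _∧ᶜ_ {b = b} cb cc = computable-≗ (λ ρ → lemma (b ρ)) (ifᶜ cb cc (constᶜ 0))
    where
    lemma : ∀ t {x} → (if t then bit x else 0) ≡ bit (t ∧ x)
    lemma true  = refl
    lemma false = refl

  _∨ᶜ_ : ∀ {b c : Vec ℕ n → Bool} → Computableᵇ b → Computableᵇ c → Computableᵇ (λ ρ → b ρ ∨ c ρ)
  _∨ᶜ_ {b = b} cb cc = computable-≗ (λ ρ → lemma (b ρ)) (ifᶜ cb (constᶜ 1) cc)
    where
    lemma : ∀ t {x} → (if t then 1 else bit x) ≡ bit (t ∨ x)
    lemma true  = refl
    lemma false = refl

  notᶜ : ∀ {b : Vec ℕ n → Bool} → Computableᵇ b → Computableᵇ (λ ρ → not (b ρ))
  notᶜ {b = b} cb = computable-≗ (λ ρ → lemma (b ρ)) (ifᶜ cb (constᶜ 0) (constᶜ 1))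
    where
    lemma : ∀ t → (if t then 0 else 1) ≡ bit (not t)
    lemma true  = refl
    lemma false = refl

  _<ᵇᶜ_ : Computable a → Computable b → Computableᵇ (λ ρ → a ρ <ᵇ b ρ)
  _<ᵇᶜ_ {a = a} {b} ca cb = computable-≗ (λ ρ → lemma (a ρ) (b ρ)) (constᶜ 1 ∸ᶜ (sucᶜ ca ∸ᶜ cb))
    where
    lemma : ∀ x y → 1 ∸ (suc x ∸ y) ≡ bit (x <ᵇ y)
    lemma x       zero    = 0∸n≡0 x
    lemma zero    (suc y) = cong (1 ∸_) (0∸n≡0 y)
    lemma (suc x) (suc y) = lemma x y

  _≡ᵇᶜ_ : Computable a → Computable b → Computableᵇ (λ ρ → a ρ ≡ᵇ b ρ)
  _≡ᵇᶜ_ {a = a} {b} ca cb = computable-≗ (λ ρ → lemma (a ρ) (b ρ))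
    (constᶜ 1 ∸ᶜ ((ca ∸ᶜ cb) +ᶜ (cb ∸ᶜ ca)))
    where
    lemma : ∀ x y → 1 ∸ ((x ∸ y) + (y ∸ x)) ≡ bit (x ≡ᵇ y)
    lemma zero    zero    = refl
    lemma zero    (suc y) = 0∸n≡0 y
    lemma (suc x) zero    = 0∸n≡0 (x + 0)
    lemma (suc x) (suc y) = lemma x y

  -- Bounded minimisation returns the bound when there is no witness below it.
  least : (ℕ → Bool) → ℕ → ℕ
  least P zero    = 0
  least P (suc k) = if least P k <ᵇ k then least P k else (if P k then k else suc k)

  leastᶜ : {P : ℕ → Vec ℕ n → Bool} → Computableᵇ {suc n} (λ ρ → P (head ρ) (tail ρ)) → Computable b →
    Computable (λ ρ → least (λ i → P i ρ) (b ρ))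
  leastᶜ {b = b} {P = P} cP cb = computable-≗ (λ ρ → lemma ρ (b ρ))
    (natrecᶜ {s = λ k r ρ → if r <ᵇ k then r else (if P k ρ then k else suc k)}
      (constᶜ 0) (ifᶜ (wk v₀ <ᵇᶜ v₀) (wk v₀) (ifᶜ (wk₁ cP) v₀ (sucᶜ v₀))) cb)
    where
    lemma : ∀ ρ k → natrec 0 (λ k r → if r <ᵇ k then r else (if P k ρ then k else suc k)) k ≡ least (λ i → P i ρ) k
    lemma ρ zero    = refl
    lemma ρ (suc k) rewrite lemma ρ k = refl

  all< : ℕ → (ℕ → Bool) → Bool
  all< zero    P = true
  all< (suc k) P = P k ∧ all< k P

  all<ᶜ : {P : ℕ → Vec ℕ n → Bool} → Computable b → Computableᵇ {suc n} (λ ρ → P (head ρ) (tail ρ)) →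
    Computableᵇ (λ ρ → all< (b ρ) (λ i → P i ρ))
  all<ᶜ {b = b} {P = P} cb cP = computable-≗ (λ ρ → lemma ρ (b ρ))
    (natrecᶜ {s = λ k r ρ → if P k ρ then r else 0} (constᶜ 1) (ifᶜ (wk₁ cP) (wk v₀) (constᶜ 0)) cb)
    where
    lemma : ∀ ρ k → natrec 1 (λ k r → if P k ρ then r else 0) k ≡ bit (all< k (λ i → P i ρ))
    lemma ρ zero    = refl
    lemma ρ (suc k) rewrite lemma ρ k with P k ρ
    ... | true  = refl
    ... | false = refl

  triᶜ : Computable₁ tri
  triᶜ {a = a} ca = computable-≗ (λ ρ → lemma (a ρ))
    (natrecᶜ {s = λ k r _ → suc k + r} (constᶜ 0) (sucᶜ v₀ +ᶜ wk v₀) ca)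
    where
    lemma : ∀ k → natrec 0 (λ k r → suc k + r) k ≡ tri k
    lemma zero    = refl
    lemma (suc k) = cong (suc k +_) (lemma k)

  pairᶜ : Computable₂ pair
  pairᶜ ca cb = triᶜ (ca +ᶜ cb) +ᶜ cb

-- Correctness of Boolean tests and bounded search

<ᵇ-true : ∀ {m n} → m < n → (m <ᵇ n) ≡ true
<ᵇ-true m<n = Equivalence.to T-≡ (<⇒<ᵇ m<n)

<ᵇ-true⁻¹ : ∀ {m n} → (m <ᵇ n) ≡ true → m < n
<ᵇ-true⁻¹ {m} {n} eq = <ᵇ⇒< m n (Equivalence.from T-≡ eq)

<ᵇ-false : ∀ {m n} → n ≤ m → (m <ᵇ n) ≡ false
<ᵇ-false {m} {n} n≤m with m <ᵇ n in eq
... | true  = ⊥-elim (<⇒≱ (<ᵇ-true⁻¹ {m} eq) n≤m)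
... | false = refl

≡ᵇ-true : ∀ n → (n ≡ᵇ n) ≡ true
≡ᵇ-true n = Equivalence.to T-≡ (≡⇒≡ᵇ n n refl)

≡ᵇ-true⁻¹ : ∀ {m n} → (m ≡ᵇ n) ≡ true → m ≡ n
≡ᵇ-true⁻¹ {m} {n} eq = ≡ᵇ⇒≡ m n (Equivalence.from T-≡ eq)

∧-true⁻¹ : ∀ {b c} → b ∧ c ≡ true → b ≡ true × c ≡ true
∧-true⁻¹ {true} eq = refl , eq

∨-true⁻¹ : ∀ {b c} → b ∨ c ≡ true → b ≡ true ⊎ c ≡ true
∨-true⁻¹ {true}  eq = inj₁ refl
∨-true⁻¹ {false} eq = inj₂ eq

true≢false : ∀ {b} → b ≡ true → b ≡ false → ⊥
true≢false refl ()

all<-true : ∀ k {P} → (∀ i → i < k → P i ≡ true) → all< k P ≡ true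
all<-true zero    h = refl
all<-true (suc k) h rewrite h k ≤-refl = all<-true k (λ i i<k → h i (m<n⇒m<1+n i<k))

all<-true⁻¹ : ∀ k {P} → all< k P ≡ true → ∀ i → i < k → P i ≡ true
all<-true⁻¹ (suc k) {P} eq i (s≤s i≤k) with m≤n⇒m<n∨m≡n i≤k
... | inj₁ i<k  = all<-true⁻¹ k (proj₂ (∧-true⁻¹ {P k} eq)) i i<k
... | inj₂ refl = proj₁ (∧-true⁻¹ eq)

all<-false⁻¹ : ∀ k {P} → all< k P ≡ false → Σ ℕ λ i → i < k × P i ≡ false
all<-false⁻¹ (suc k) {P} eq with P k in p
... | false = k , ≤-refl , p
... | true  with all<-false⁻¹ k eq
...   | i , i<k , q = i , m<n⇒m<1+n i<k , q

least-≤ : ∀ P k → least P k ≤ k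
least-≤ P zero    = z≤n
least-≤ P (suc k) with least P k <ᵇ k in eq
... | true  = m≤n⇒m≤1+n (<⇒≤ (<ᵇ-true⁻¹ eq))
... | false with P k
...   | true  = n≤1+n k
...   | false = ≤-refl

least-found : ∀ P k → least P k < k → P (least P k) ≡ true
least-found P (suc k) lt with least P k <ᵇ k in eq
... | true  = least-found P k (<ᵇ-true⁻¹ eq)
... | false with P k in p
...   | true  = p
...   | false = ⊥-elim (<-irrefl refl lt)

least-min : ∀ P k i → i < k → P i ≡ true → least P k ≤ i
least-min P (suc k) i (s≤s i≤k) p with m≤n⇒m<n∨m≡n i≤k
... | inj₁ i<k with least-min P k i i<k p
...   | le rewrite <ᵇ-true (≤-<-trans le i<k) = le
least-min P (suc k) i (s≤s i≤k) p | inj₂ refl with least P k <ᵇ k in eq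
... | true  = <⇒≤ (<ᵇ-true⁻¹ eq)
... | false rewrite p = ≤-refl

least-≡ : ∀ P k i → i < k → P i ≡ true → (∀ j → j < i → P j ≡ false) → least P k ≡ i
least-≡ P k i i<k p min = ≤-antisym le (≮⇒≥ λ lt →
  true≢false (least-found P k (≤-<-trans le i<k)) (min _ lt))
  where le = least-min P k i i<k p

-- Pairing and finite sets as bit patterns

hd tl : ℕ → ℕ
hd n = proj₁ (unpair n)
tl n = proj₂ (unpair n)

pair-suc : ∀ x y → pair x (suc y) ≡ suc (pair (suc x) y)
pair-suc x y rewrite +-suc x y = +-suc (tri (suc (x + y))) y

pair-suc-0 : ∀ x → pair (suc x) 0 ≡ suc (pair 0 x)
pair-suc-0 x rewrite +-identityʳ x | +-identityʳ (x + tri x) = cong suc (+-comm x (tri x))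

pair-hd-tl : ∀ n → pair (hd n) (tl n) ≡ n
pair-hd-tl zero = refl
pair-hd-tl (suc n) with unpair n | pair-hd-tl n
... | zero  , y | eq = trans (pair-suc-0 y) (cong suc eq)
... | suc x , y | eq = trans (pair-suc x y) (cong suc eq)

nextPair : ℕ × ℕ → ℕ × ℕ
nextPair (zero  , y) = suc y , 0
nextPair (suc x , y) = x , suc y

unpair-suc : ∀ n → unpair (suc n) ≡ nextPair (unpair n)
unpair-suc n with unpair n
... | zero  , y = refl
... | suc x , y = refl

unpair-pair : ∀ x y → unpair (pair x y) ≡ (x , y)
unpair-pair x y = go (x + y) y x refl
  where
  next : ∀ {n m p} → n ≡ suc m → unpair m ≡ p → unpair n ≡ nextPair p
  next {m = m} eq ih = trans (cong unpair eq) (trans (unpair-suc m) (cong nextPair ih))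
  -- Backwards along the enumeration: `y` decreases within a diagonal, and from its start
  -- `(suc x , 0)` one passes to the end `(0 , x)` of the previous one.
  go : ∀ s y x → x + y ≡ s → unpair (pair x y) ≡ (x , y)
  go s (suc y) x eq = next (pair-suc x y) (go s y (suc x) (trans (sym (+-suc x y)) eq))
  go s zero zero eq = refl
  go (suc s) zero (suc x) eq =
    next (pair-suc-0 x) (go s x zero (suc-injective (trans (sym (+-identityʳ (suc x))) eq)))

hd-pair : ∀ x y → hd (pair x y) ≡ x
hd-pair x y = cong proj₁ (unpair-pair x y)

tl-pair : ∀ x y → tl (pair x y) ≡ y
tl-pair x y = cong proj₂ (unpair-pair x y)

n≤tri : ∀ n → n ≤ tri n
n≤tri zero    = z≤n
n≤tri (suc n) = m≤m+n (suc n) (tri n)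

tri-mono : ∀ {m n} → m ≤ n → tri m ≤ tri n
tri-mono z≤n       = z≤n
tri-mono (s≤s m≤n) = +-mono-≤ (s≤s m≤n) (tri-mono m≤n)

x≤pair : ∀ x y → x ≤ pair x y
x≤pair x y = ≤-trans (m≤m+n x y) (≤-trans (n≤tri (x + y)) (m≤m+n _ y))

y≤pair : ∀ x y → y ≤ pair x y
y≤pair x y = m≤n+m y (tri (x + y))

hd≤ : ∀ n → hd n ≤ n
hd≤ n = subst (hd n ≤_) (pair-hd-tl n) (x≤pair (hd n) (tl n))

tl≤ : ∀ n → tl n ≤ n
tl≤ n = subst (tl n ≤_) (pair-hd-tl n) (y≤pair (hd n) (tl n))

-- `unpair` recurses through pairs, which a loop on numbers could carry only if the projections were
-- already known to be computable. Finding the diagonal by bounded search avoids the circle.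
diagonal : ℕ → ℕ
diagonal n = least (λ d → n <ᵇ tri (suc d)) (suc n)

diagonal-pair : ∀ x y → diagonal (pair x y) ≡ x + y
diagonal-pair x y = least-≡ _ _ (x + y)
  (s≤s (≤-trans (n≤tri (x + y)) (m≤m+n _ y)))
  (<ᵇ-true (s≤s (subst (_≤ x + y + tri (x + y)) (+-comm y (tri (x + y))) (+-monoˡ-≤ _ (m≤n+m y x)))))
  λ j j<k → <ᵇ-false (≤-trans (tri-mono j<k) (m≤m+n _ y))

tl-diagonal : ∀ n → n ∸ tri (diagonal n) ≡ tl n
tl-diagonal n = subst (λ k → k ∸ tri (diagonal k) ≡ tl n) (pair-hd-tl n)
  (trans (cong (λ d → pair (hd n) (tl n) ∸ tri d) (diagonal-pair (hd n) (tl n)))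
         (m+n∸m≡n (tri (hd n + tl n)) (tl n)))

hd-diagonal : ∀ n → diagonal n ∸ (n ∸ tri (diagonal n)) ≡ hd n
hd-diagonal n = trans
  (cong₂ _∸_ (trans (cong diagonal (sym (pair-hd-tl n))) (diagonal-pair (hd n) (tl n))) (tl-diagonal n))
  (m+n∸n≡m (hd n) (tl n))

diagonalᶜ : Computable₁ diagonal
diagonalᶜ {a = a} ca =
  leastᶜ {P = λ d ρ → a ρ <ᵇ tri (suc d)} (wk ca <ᵇᶜ triᶜ (sucᶜ v₀)) (sucᶜ ca)

tlᶜ : Computable₁ tl
tlᶜ {a = a} ca = computable-≗ (λ ρ → tl-diagonal (a ρ)) (ca ∸ᶜ triᶜ (diagonalᶜ ca))

hdᶜ : Computable₁ hd
hdᶜ {a = a} ca = computable-≗ (λ ρ → hd-diagonal (a ρ))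
  (diagonalᶜ ca ∸ᶜ (ca ∸ᶜ triᶜ (diagonalᶜ ca)))

_/ᶜ_ : ∀ {n} {a b : Vec ℕ n → ℕ} → Computable a → Computable b → Computable (λ ρ → a ρ / suc (b ρ))
_/ᶜ_ {a = a} {b} ca cb = computable-≗ (λ ρ → lemma (a ρ) (b ρ))
  (leastᶜ {P = λ q ρ → a ρ <ᵇ suc q * suc (b ρ)} (wk ca <ᵇᶜ (sucᶜ v₀ *ᶜ sucᶜ (wk cb))) (sucᶜ ca))
  where
  lemma : ∀ m d → least (λ q → m <ᵇ suc q * suc d) (suc m) ≡ m / suc d
  lemma m d = least-≡ _ _ (m / suc d) (s≤s (m/n≤m m (suc d)))
    (<ᵇ-true (subst (_< suc d + m / suc d * suc d) (sym (m≡m%n+[m/n]*n m (suc d)))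
      (+-monoˡ-< (m / suc d * suc d) (m%n<n m (suc d)))))
    λ j j<q → <ᵇ-false (≤-trans (*-monoˡ-≤ (suc d) j<q) (m/n*n≤m m (suc d)))

_%ᶜ_ : ∀ {n} {a b : Vec ℕ n → ℕ} → Computable a → Computable b → Computable (λ ρ → a ρ % suc (b ρ))
_%ᶜ_ {a = a} {b} ca cb = computable-≗ (λ ρ → sym (m%n≡m∸m/n*n (a ρ) (suc (b ρ))))
  (ca ∸ᶜ ((ca /ᶜ cb) *ᶜ sucᶜ cb))

nth : ℕ → ℕ → ℕ
nth a zero    = hd a
nth a (suc i) = nth (tl a) i

nthᶜ : Computable₂ nth
nthᶜ {a = a} {b} ca cb = computable-≗ (λ ρ → lemma (a ρ) (b ρ))
  (hdᶜ (natrecᶜ {s = λ _ r _ → tl r} ca (tlᶜ (wk v₀)) cb))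
  where
  tls : ℕ → ℕ → ℕ
  tls a = natrec a (λ _ → tl)
  tls-tl : ∀ a i → tl (tls a i) ≡ tls (tl a) i
  tls-tl a zero    = refl
  tls-tl a (suc i) = cong tl (tls-tl a i)
  lemma : ∀ a i → hd (tls a i) ≡ nth a i
  lemma a zero    = refl
  lemma a (suc i) = trans (cong hd (tls-tl a i)) (lemma (tl a) i)

tabulateℕ : (ℕ → ℕ) → ℕ → ℕ
tabulateℕ f zero    = 0
tabulateℕ f (suc k) = pair (f 0) (tabulateℕ (f ∘ suc) k)

nth-tabulateℕ : ∀ f k i → i < k → nth (tabulateℕ f k) i ≡ f i
nth-tabulateℕ f (suc k) zero    lt = hd-pair (f 0) _
nth-tabulateℕ f (suc k) (suc i) (s≤s lt) =
  trans (cong (λ a → nth a i) (tl-pair (f 0) _)) (nth-tabulateℕ (f ∘ suc) k i lt)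

testBitᶜ : ∀ {n} {a b : Vec ℕ n → ℕ} → Computable a → Computable b → Computableᵇ (λ ρ → testBit (a ρ) (b ρ))
testBitᶜ {a = a} {b} ca cb = computable-≗ (λ ρ → cong bit (lemma (a ρ) (b ρ)))
  ((natrecᶜ {s = λ _ r _ → r / 2} ca (wk v₀ /ᶜ constᶜ 1) cb %ᶜ constᶜ 1) ≡ᵇᶜ constᶜ 1)
  where
  halves : ℕ → ℕ → ℕ
  halves c = natrec c (λ _ r → r / 2)
  halves-/ : ∀ c x → halves c x / 2 ≡ halves (c / 2) x
  halves-/ c zero    = refl
  halves-/ c (suc x) = cong (_/ 2) (halves-/ c x)
  lemma : ∀ c x → (halves c x % 2 ≡ᵇ 1) ≡ testBit c x
  lemma c zero    = refl
  lemma c (suc x) = trans (cong (λ z → z % 2 ≡ᵇ 1) (halves-/ c x)) (lemma (c / 2) x)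

pow2ᶜ : Computable₁ pow2
pow2ᶜ {a = a} ca = computable-≗ (λ ρ → lemma (a ρ))
  (natrecᶜ {s = λ _ r _ → 2 * r} (constᶜ 1) (constᶜ 2 *ᶜ wk v₀) ca)
  where
  lemma : ∀ k → natrec 1 (λ _ → 2 *_) k ≡ pow2 k
  lemma zero    = refl
  lemma (suc k) = cong (2 *_) (lemma k)

insertSetᶜ : Computable₂ insertSet
insertSetᶜ ca cb = ifᶜ (testBitᶜ cb ca) cb (cb +ᶜ pow2ᶜ ca)

even-or-odd : ∀ c → (Σ ℕ λ q → c ≡ q * 2) ⊎ (Σ ℕ λ q → c ≡ 1 + q * 2)
even-or-odd c with c % 2 | m≡m%n+[m/n]*n c 2 | m%n<n c 2
... | 0 | eq | _ = inj₁ (c / 2 , eq)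
... | 1 | eq | _ = inj₂ (c / 2 , eq)
... | suc (suc _) | _ | s≤s (s≤s ())

c+k*2%2 : ∀ c k → (c + k * 2) % 2 ≡ c % 2
c+k*2%2 c k = [m+kn]%n≡m%n c k 2

c+k*2/2 : ∀ c k → (c + k * 2) / 2 ≡ c / 2 + k
c+k*2/2 c k = trans (+-distrib-/-∣ʳ c (n∣m*n k)) (cong (c / 2 +_) (m*n/n≡m k 2))

-- As bit `x` is clear, the addition produces no carry.
testBit-+pow2 : ∀ x c → testBit c x ≡ false → ∀ y → testBit (c + pow2 x) y ≡ (x ≡ᵇ y) ∨ testBit c y
testBit-+pow2 zero c h y with even-or-odd c
... | inj₂ (q , refl) = ⊥-elim (true≢false (cong (_≡ᵇ 1) (c+k*2%2 1 q)) h)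
... | inj₁ (q , refl) = trans (cong (λ c → testBit c y) (+-comm (q * 2) 1)) (go y)
  where
  go : ∀ y → testBit (1 + q * 2) y ≡ (0 ≡ᵇ y) ∨ testBit (q * 2) y
  go zero    = cong (_≡ᵇ 1) (c+k*2%2 1 q)
  go (suc y) = cong (λ c → testBit c y) (trans (c+k*2/2 1 q) (sym (c+k*2/2 0 q)))
testBit-+pow2 (suc x) c h zero = cong (_≡ᵇ 1)
  (trans (cong (λ p → (c + p) % 2) (*-comm 2 (pow2 x))) (c+k*2%2 c (pow2 x)))
testBit-+pow2 (suc x) c h (suc y) = trans
  (cong (λ c → testBit c y) (trans (cong (λ p → (c + p) / 2) (*-comm 2 (pow2 x))) (c+k*2/2 c (pow2 x))))
  (testBit-+pow2 x (c / 2) h y)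

testBit-insertSet : ∀ x c y → testBit (insertSet x c) y ≡ (x ≡ᵇ y) ∨ testBit c y
testBit-insertSet x c y with testBit c x in eq
... | false = testBit-+pow2 x c eq y
... | true  with x ≡ᵇ y in e
...   | false = refl
...   | true  = trans (cong (testBit c) (sym (≡ᵇ-true⁻¹ {x} e))) eq

testBit-0 : ∀ x → testBit 0 x ≡ false
testBit-0 zero    = refl
testBit-0 (suc x) = testBit-0 x

contentCode-complete : ∀ T n i x → i < n → T i ≡ just x → testBit (contentCode T n) x ≡ true
contentCode-complete T (suc n) zero x lt eq rewrite eq
  | testBit-insertSet x (contentCode (T ∘ suc) n) x | ≡ᵇ-true x = refl
contentCode-complete T (suc n) (suc i) x (s≤s lt) eq with T 0
... | nothing = contentCode-complete (T ∘ suc) n i x lt eq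
... | just z rewrite testBit-insertSet z (contentCode (T ∘ suc) n) x
                   | contentCode-complete (T ∘ suc) n i x lt eq = ∨-zeroʳ (z ≡ᵇ x)

contentCode-sound : ∀ T n x → testBit (contentCode T n) x ≡ true → content T x
contentCode-sound T zero x eq = ⊥-elim (true≢false eq (testBit-0 x))
contentCode-sound T (suc n) x eq with T 0 in e
... | nothing with contentCode-sound (T ∘ suc) n x eq
...   | i , q = suc i , q
contentCode-sound T (suc n) x eq | just z
  with ∨-true⁻¹ {z ≡ᵇ x} (trans (sym (testBit-insertSet z (contentCode (T ∘ suc) n) x)) eq)
... | inj₁ z≡x = 0 , trans e (cong just (≡ᵇ-true⁻¹ {z} z≡x))
... | inj₂ q with contentCode-sound (T ∘ suc) n x q
...   | i , p = suc i , p

-- Properties that hold from some time on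

Eventually : (ℕ → Set) → Set
Eventually P = Σ ℕ λ s → ∀ t → s ≤ t → P t

always : ∀ {P : ℕ → Set} → (∀ t → P t) → Eventually P
always h = 0 , λ t _ → h t

eventually-≥ : ∀ k → Eventually (k ≤_)
eventually-≥ k = k , λ _ le → le

ev-map : ∀ {P Q : ℕ → Set} → (∀ t → P t → Q t) → Eventually P → Eventually Q
ev-map f (s , h) = s , λ t le → f t (h t le)

ev-map₂ : ∀ {P Q R : ℕ → Set} → (∀ t → P t → Q t → R t) → Eventually P → Eventually Q → Eventually R
ev-map₂ f (s , h) (s′ , h′) = s ⊔ s′ , λ t le →
  f t (h t (≤-trans (m≤m⊔n s s′) le)) (h′ t (≤-trans (m≤n⊔m s s′) le))

-- Bounds can be combined only over a finite range. This is why the guess must later be confined to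
-- finitely many candidates.
ev-∀< : ∀ k {P : ℕ → ℕ → Set} → (∀ i → i < k → Eventually (P i)) →
  Eventually (λ t → ∀ i → i < k → P i t)
ev-∀< zero    h = always λ t i ()
ev-∀< (suc k) {P} h = ev-map₂ f (h k ≤-refl) (ev-∀< k (λ i i<k → h i (m<n⇒m<1+n i<k)))
  where
  f : ∀ t → P k t → (∀ i → i < k → P i t) → ∀ i → i < suc k → P i t
  f t p q i (s≤s i≤k) with m≤n⇒m<n∨m≡n i≤k
  ... | inj₁ i<k  = q i i<k
  ... | inj₂ refl = p

-- Gödel numbering

-- With tag 0 this fails at `e` equal to 0, but that tag carries no subprogram. So every recursive
-- call of the decoding is on a smaller number.
quotient< : ∀ {e k} → e % 6 ≡ suc k → e / 6 < e
quotient< {e} {k} eq = subst (e / 6 <_) (sym (m≡m%n+[m/n]*n e 6))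
  (subst (λ r → e / 6 < r + e / 6 * 6) (sym eq) (s≤s (≤-trans (m≤m*n (e / 6) 6) (m≤n+m _ k))))

-- The case tree of decT inspects the arity first, so these hold only by cases.
decT-proj : ∀ f n r → decT f (suc n) 2 r ≡ proj (r mod suc n)
decT-proj f zero    r = refl
decT-proj f (suc n) r = refl

decT-comp : ∀ f n r → decT f n 3 r ≡ comp (dec f (hd (hd r)) (tl (hd r))) (decVec f n (hd (hd r)) (tl r))
decT-comp f zero          r = refl
decT-comp f (suc zero)    r = refl
decT-comp f (suc (suc n)) r = refl

decT-prec : ∀ f n r → decT f (suc n) 4 r ≡ prec (dec f n (hd r)) (dec f (suc (suc n)) (tl r))
decT-prec f zero    r = refl
decT-prec f (suc n) r = refl

decT-mu : ∀ f n t r → decT f n (5 + t) r ≡ mu (dec f (suc n) r)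
decT-mu f zero          t r = refl
decT-mu f (suc zero)    t r = refl
decT-mu f (suc (suc n)) t r = refl

mutual
  dec-fuel : ∀ f g n e → e < f → e < g → dec f n e ≡ dec g n e
  dec-fuel (suc f) (suc g) n e (s≤s e≤f) (s≤s e≤g) =
    decT-fuel f g n (e % 6) (e / 6) λ k eq →
      ≤-trans (quotient< eq) e≤f , ≤-trans (quotient< eq) e≤g

  decT-fuel : ∀ f g n t r → (∀ k → t ≡ suc k → r < f × r < g) → decT f n t r ≡ decT g n t r
  decT-fuel f g n 0 r h = refl
  decT-fuel f g 0 1 r h = refl
  decT-fuel f g 1 1 r h = refl
  decT-fuel f g (suc (suc n)) 1 r h = refl
  decT-fuel f g 0 2 r h = refl
  decT-fuel f g (suc n) 2 r h = trans (decT-proj f n r) (sym (decT-proj g n r))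
  decT-fuel f g n 3 r h with h 2 refl
  ... | r<f , r<g = trans (decT-comp f n r) (trans (cong₂ comp
    (dec-fuel f g _ _ (≤-<-trans (≤-trans (tl≤ (hd r)) (hd≤ r)) r<f) (≤-<-trans (≤-trans (tl≤ (hd r)) (hd≤ r)) r<g))
    (decVec-fuel f g n _ _ (≤-<-trans (tl≤ r) r<f) (≤-<-trans (tl≤ r) r<g))) (sym (decT-comp g n r)))
  decT-fuel f g 0 4 r h = refl
  decT-fuel f g (suc n) 4 r h with h 3 refl
  ... | r<f , r<g = trans (decT-prec f n r) (trans (cong₂ prec
    (dec-fuel f g _ _ (≤-<-trans (hd≤ r) r<f) (≤-<-trans (hd≤ r) r<g))
    (dec-fuel f g _ _ (≤-<-trans (tl≤ r) r<f) (≤-<-trans (tl≤ r) r<g))) (sym (decT-prec g n r)))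
  decT-fuel f g n (suc (suc (suc (suc (suc t))))) r h with h _ refl
  ... | r<f , r<g =
    trans (decT-mu f n t r) (trans (cong mu (dec-fuel f g _ _ r<f r<g)) (sym (decT-mu g n t r)))

  decVec-fuel : ∀ f g n m b → b < f → b < g → decVec f n m b ≡ decVec g n m b
  decVec-fuel f g n zero    b b<f b<g = refl
  decVec-fuel f g n (suc m) b b<f b<g = cong₂ _∷_
    (dec-fuel f g _ _ (≤-<-trans (hd≤ b) b<f) (≤-<-trans (hd≤ b) b<g))
    (decVec-fuel f g n m _ (≤-<-trans (tl≤ b) b<f) (≤-<-trans (tl≤ b) b<g))

tag-% : ∀ k r → k < 6 → (k + r * 6) % 6 ≡ k
tag-% k r k<6 = trans ([m+kn]%n≡m%n k r 6) (m<n⇒m%n≡m k<6)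

tag-/ : ∀ k r → k < 6 → (k + r * 6) / 6 ≡ r
tag-/ k r k<6 = trans (+-distrib-/-∣ʳ k (n∣m*n r)) (cong₂ _+_ (m<n⇒m/n≡0 k<6) (m*n/n≡m r 6))

tag-dec : ∀ k r {n p} → k < 6 → (∀ f → r < f ⊎ k ≡ 0 → decT f n k r ≡ p) → ∀ f → k + r * 6 < f → dec f n (k + r * 6) ≡ p
tag-dec k r {n} {p} k<6 h (suc f) (s≤s le) =
  subst₂ (λ t q → decT f n t q ≡ p) (sym (tag-% k r k<6)) (sym (tag-/ k r k<6)) (h f (bound k le))
  where
  bound : ∀ k → k + r * 6 ≤ f → r < f ⊎ k ≡ 0
  bound zero    le = inj₂ refl
  bound (suc k) le = inj₁ (≤-trans (s≤s (≤-trans (m≤m*n r 6) (m≤n+m _ k))) le)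

mutual
  encode : ∀ {n} → PR n → ℕ
  encode zer           = 0
  encode succ          = 1
  encode (proj i)      = 2 + toℕ i * 6
  encode (comp {m} p ps) = 3 + pair (pair m (encode p)) (encode* ps) * 6
  encode (prec p q)    = 4 + pair (encode p) (encode q) * 6
  encode (mu p)        = 5 + encode p * 6

  encode* : ∀ {m n} → Vec (PR n) m → ℕ
  encode* []       = 0
  encode* (p ∷ ps) = pair (encode p) (encode* ps)

mutual
  dec-encode : ∀ {n} (p : PR n) f → encode p < f → dec f n (encode p) ≡ p
  dec-encode zer (suc f) _ = refl
  dec-encode succ (suc f) _ = refl
  dec-encode (proj {suc n} i) = tag-dec 2 (toℕ i) (s≤s (s≤s (s≤s z≤n))) λ f _ →
    trans (decT-proj f n (toℕ i)) (cong proj (toℕ-injective (trans (toℕ-fromℕ< (m%n<n (toℕ i) (suc n))) (m<n⇒m%n≡m (toℕ<n i)))))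
  dec-encode {n} (comp {m} p ps) = tag-dec 3 r (s≤s (s≤s (s≤s (s≤s z≤n)))) λ
    { f (inj₁ r<f) → go f r<f }
    where
    r = pair (pair m (encode p)) (encode* ps)
    go : ∀ f → r < f → decT f n 3 r ≡ comp p ps
    go f r<f rewrite decT-comp f n r | hd-pair (pair m (encode p)) (encode* ps) | tl-pair (pair m (encode p)) (encode* ps)
      | hd-pair m (encode p) | tl-pair m (encode p) = cong₂ comp
      (dec-encode p f (≤-<-trans (≤-trans (y≤pair m (encode p)) (x≤pair _ (encode* ps))) r<f))
      (dec-encode* ps f (≤-<-trans (y≤pair (pair m (encode p)) _) r<f))
  dec-encode {suc n} (prec p q) = tag-dec 4 r (s≤s (s≤s (s≤s (s≤s (s≤s z≤n))))) λ
    { f (inj₁ r<f) → go f r<f }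
    where
    r = pair (encode p) (encode q)
    go : ∀ f → r < f → decT f (suc n) 4 r ≡ prec p q
    go f r<f rewrite decT-prec f n r | hd-pair (encode p) (encode q) | tl-pair (encode p) (encode q) = cong₂ prec
      (dec-encode p f (≤-<-trans (x≤pair (encode p) (encode q)) r<f))
      (dec-encode q f (≤-<-trans (y≤pair (encode p) (encode q)) r<f))
  dec-encode {n} (mu p) = tag-dec 5 (encode p) ≤-refl λ
    { f (inj₁ r<f) → trans (decT-mu f n 0 (encode p)) (cong mu (dec-encode p f r<f)) }

  dec-encode* : ∀ {m n} (ps : Vec (PR n) m) f → encode* ps < f → decVec f n m (encode* ps) ≡ ps
  dec-encode* [] f _ = refl
  dec-encode* (p ∷ ps) f lt rewrite hd-pair (encode p) (encode* ps) | tl-pair (encode p) (encode* ps) =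
    cong₂ _∷_ (dec-encode p f (≤-<-trans (x≤pair (encode p) _) lt))
              (dec-encode* ps f (≤-<-trans (y≤pair (encode p) _) lt))

program-encode : ∀ p → program (encode p) ≡ p
program-encode p = dec-encode p (suc (encode p)) ≤-refl

-- Step-bounded evaluation

-- A judgement (n , e , a , y) asserts that the n-ary program with number e
-- maps the argument tuple coded by a to y.
opaque
  judgement : (n e a y : ℕ) → ℕ
  judgement n e a y = pair n (pair e (pair a y))

  arityOf programOf argsOf valueOf : ℕ → ℕ
  arityOf j = hd j
  programOf j = hd (tl j)
  argsOf j = hd (tl (tl j))
  valueOf j = tl (tl (tl j))

  arityOf-judgement : ∀ n e a y → arityOf (judgement n e a y) ≡ n
  arityOf-judgement n e a y = hd-pair n _

  programOf-judgement : ∀ n e a y → programOf (judgement n e a y) ≡ e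
  programOf-judgement n e a y = trans (cong hd (tl-pair n _)) (hd-pair e _)

  argsOf-judgement : ∀ n e a y → argsOf (judgement n e a y) ≡ a
  argsOf-judgement n e a y =
    trans (cong (hd ∘ tl) (tl-pair n _)) (trans (cong hd (tl-pair e _)) (hd-pair a y))

  valueOf-judgement : ∀ n e a y → valueOf (judgement n e a y) ≡ y
  valueOf-judgement n e a y =
    trans (cong (tl ∘ tl) (tl-pair n _)) (trans (cong tl (tl-pair e _)) (tl-pair a y))

  judgementᶜ : ∀ {m} {a b c d : Vec ℕ m → ℕ} → Computable a → Computable b → Computable c → Computable d →
    Computable (λ ρ → judgement (a ρ) (b ρ) (c ρ) (d ρ))
  judgementᶜ ca cb cc cd = pairᶜ ca (pairᶜ cb (pairᶜ cc cd))

  arityOfᶜ : Computable₁ arityOf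
  arityOfᶜ cj = hdᶜ cj

  programOfᶜ : Computable₁ programOf
  programOfᶜ cj = hdᶜ (tlᶜ cj)

  argsOfᶜ : Computable₁ argsOf
  argsOfᶜ cj = hdᶜ (tlᶜ (tlᶜ cj))

  valueOfᶜ : Computable₁ valueOf
  valueOfᶜ cj = tlᶜ (tlᶜ (tlᶜ cj))

holds : (db n e a y : ℕ) → Bool
holds db n e a y = testBit db (judgement n e a y)

-- One inference from the set db of judgements derived so far; w codes the
-- intermediate values.
ruleT : (t r db n e a y w : ℕ) → Bool
ruleT t r db n e a y w =
  if t ≡ᵇ 0 then y ≡ᵇ 0 else
  if t ≡ᵇ 1 then (if n ≡ᵇ 1 then y ≡ᵇ suc (hd a) else y ≡ᵇ 0) else
  if t ≡ᵇ 2 then (if n ≡ᵇ 0 then y ≡ᵇ 0 else y ≡ᵇ nth a (r % suc (pred n))) else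
  if t ≡ᵇ 3 then
    holds db (hd (hd r)) (tl (hd r)) w y ∧
    all< (hd (hd r)) (λ i → holds db n (nth (tl r) i) a (nth w i)) else
  if t ≡ᵇ 4 then (if n ≡ᵇ 0 then y ≡ᵇ 0 else
    if hd a ≡ᵇ 0 then holds db (pred n) (hd r) (tl a) y else
      holds db n e (pair (pred (hd a)) (tl a)) w ∧
      holds db (suc n) (tl r) (pair (pred (hd a)) (pair w (tl a))) y) else
  -- For minimisation, entry `j` of `w` is one less than the value at `j`, so that the judgement
  -- itself says the value is nonzero.
  holds db (suc n) r (pair y a) 0 ∧
  all< y (λ j → holds db (suc n) r (pair j a) (suc (nth w j)))

opaque
  rule : (db n e a y w : ℕ) → Bool
  rule db n e a y w = ruleT (e % 6) (e / 6) db n e a y w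

ruleAt : (db j w : ℕ) → Bool
ruleAt db j w = rule db (arityOf j) (programOf j) (argsOf j) (valueOf j) w

ruleAt-judgement : ∀ db n e a y w → ruleAt db (judgement n e a y) w ≡ rule db n e a y w
ruleAt-judgement db n e a y w
  rewrite arityOf-judgement n e a y | programOf-judgement n e a y
        | argsOf-judgement n e a y | valueOf-judgement n e a y = refl

-- Stage `s` codes a judgement, a witness and a padding. Because of the padding, every attempt is
-- repeated after any given stage, hence also after its premises have been derived.
extend : ℕ → ℕ → ℕ
extend s db = if ruleAt db (hd s) (hd (tl s)) then insertSet (hd s) db else db

derived : ℕ → ℕ
derived = natrec 0 extend

vdec : ∀ n → ℕ → Vec ℕ n
vdec zero    a = []
vdec (suc n) a = hd a ∷ vdec n (tl a)

vcode : ∀ {n} → Vec ℕ n → ℕ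
vcode []       = 0
vcode (x ∷ xs) = pair x (vcode xs)

vdec-vcode : ∀ {n} (xs : Vec ℕ n) → vdec n (vcode xs) ≡ xs
vdec-vcode [] = refl
vdec-vcode (x ∷ xs) = cong₂ _∷_ (hd-pair x _)
  (trans (cong (vdec _) (tl-pair x _)) (vdec-vcode xs))

lookup-vdec : ∀ n a i → lookup (vdec n a) i ≡ nth a (toℕ i)
lookup-vdec (suc n) a zero    = refl
lookup-vdec (suc n) a (suc i) = lookup-vdec n (tl a) i

nth-vcode : ∀ {n} (xs : Vec ℕ n) i → nth (vcode xs) (toℕ i) ≡ lookup xs i
nth-vcode (x ∷ xs) zero    = hd-pair x _
nth-vcode (x ∷ xs) (suc i) = trans (cong (λ a → nth a (toℕ i)) (tl-pair x _)) (nth-vcode xs i)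

toℕ-mod : ∀ r n → toℕ (r mod suc n) ≡ r % suc n
toℕ-mod r n = toℕ-fromℕ< (m%n<n r (suc n))

Sound : ℕ → Set
Sound db = ∀ n e a y → holds db n e a y ≡ true → dec (suc e) n e ⊢ vdec n a ⇓ y

module _ {db} (sound : Sound db) where

  ruleT-sound : ∀ t r n e a y w → (∀ k → t ≡ suc k → r < e) → dec (suc e) n e ≡ decT e n t r →
    ruleT t r db n e a y w ≡ true → decT e n t r ⊢ vdec n a ⇓ y
  ruleT-sound t r n e a y w bound self = go t n bound self
    where
    sub : ∀ n′ e′ a′ y′ → e′ < e → holds db n′ e′ a′ y′ ≡ true → dec e n′ e′ ⊢ vdec n′ a′ ⇓ y′
    sub n′ e′ a′ y′ lt h = subst (_⊢ vdec n′ a′ ⇓ y′) (dec-fuel (suc e′) e n′ e′ ≤-refl lt) (sound n′ e′ a′ y′ h)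

    zero-⇓ : ∀ {n} {xs : Vec ℕ n} → (y ≡ᵇ 0) ≡ true → zer ⊢ xs ⇓ y
    zero-⇓ h with refl ← ≡ᵇ-true⁻¹ {y} h = ev-zer

    args : ∀ n m b v → b < e → (∀ i → i < m → holds db n (nth b i) a (nth v i) ≡ true) →
      decVec e n m b ⊢* vdec n a ⇓ vdec m v
    args n zero    b v b<e h = ev-[]
    args n (suc m) b v b<e h = ev-∷
      (sub n (hd b) a (hd v) (≤-<-trans (hd≤ b) b<e) (h 0 (s≤s z≤n)))
      (args n m (tl b) (tl v) (≤-<-trans (tl≤ b) b<e) (λ i i<m → h (suc i) (s≤s i<m)))

    go : ∀ t n → (∀ k → t ≡ suc k → r < e) → dec (suc e) n e ≡ decT e n t r →
      ruleT t r db n e a y w ≡ true → decT e n t r ⊢ vdec n a ⇓ y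
    go 0 n _ _ h = zero-⇓ h
    go 1 0 _ _ h = zero-⇓ h
    go 1 1 _ _ h rewrite ≡ᵇ-true⁻¹ {y} h = ev-succ
    go 1 (suc (suc n)) _ _ h = zero-⇓ h
    go 2 0 _ _ h = zero-⇓ h
    go 2 (suc n) _ _ h rewrite decT-proj e n r = subst (proj i ⊢ vdec (suc n) a ⇓_)
      (trans (lookup-vdec (suc n) a i) (trans (cong (nth a) (toℕ-mod r n)) (sym (≡ᵇ-true⁻¹ {y} h)))) ev-proj
      where i = r mod suc n
    go 3 n bound _ h rewrite decT-comp e n r with ∧-true⁻¹ h
    ... | h₁ , h₂ = ev-comp
      (args n _ (tl r) w (≤-<-trans (tl≤ r) r<e) (all<-true⁻¹ (hd (hd r)) h₂))
      (sub _ _ w y (≤-<-trans (≤-trans (tl≤ (hd r)) (hd≤ r)) r<e) h₁)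
      where r<e = bound 2 refl
    go 4 0 _ _ h = zero-⇓ h
    go 4 (suc n) bound self h rewrite decT-prec e n r with hd a in eq
    ... | zero = ev-prec0 (sub n (hd r) (tl a) y (≤-<-trans (hd≤ r) (bound 3 refl)) h)
    ... | suc k with ∧-true⁻¹ h
    -- The first premise concerns the program `e` itself rather than a subprogram; `self` identifies
    -- it with the `prec` at hand.
    ...   | h₁ , h₂ = ev-precS {k = k} {y = w}
      (subst₂ (λ p v → p ⊢ v ⇓ w) self (args-≡ k (tl a)) (sound (suc n) e (pair k (tl a)) w h₁))
      (subst (dec e (suc (suc n)) (tl r) ⊢_⇓ y)
        (trans (args-≡ k _) (cong (k ∷_) (args-≡ w (tl a))))
        (sub (suc (suc n)) (tl r) _ y (≤-<-trans (tl≤ r) (bound 3 refl)) h₂))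
      where
      args-≡ : ∀ x {n} b → vdec (suc n) (pair x b) ≡ x ∷ vdec n b
      args-≡ x b = cong₂ (λ z v → z ∷ vdec _ v) (hd-pair x b) (tl-pair x b)
    go (suc (suc (suc (suc (suc t))))) n bound _ h rewrite decT-mu e n t r with ∧-true⁻¹ h
    ... | h₁ , h₂ = ev-mu (at y 0 h₁) (λ j j<y → nth w j , at j _ (all<-true⁻¹ y h₂ j j<y))
      where
      at : ∀ x z → holds db (suc n) r (pair x a) z ≡ true → dec e (suc n) r ⊢ x ∷ vdec n a ⇓ z
      at x z h = subst (dec e (suc n) r ⊢_⇓ z)
        (cong₂ (λ u v → u ∷ vdec n v) (hd-pair x a) (tl-pair x a))
        (sub (suc n) r (pair x a) z (bound _ refl) h)

  opaque
    unfolding rule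
    rule-sound : ∀ n e a y w → rule db n e a y w ≡ true → dec (suc e) n e ⊢ vdec n a ⇓ y
    rule-sound n e a y w = ruleT-sound (e % 6) (e / 6) n e a y w (λ k → quotient< {e}) refl

  extend-sound : ∀ s → Sound (extend s db)
  extend-sound s n e a y h with ruleAt db (hd s) (hd (tl s)) in eq
  ... | false = sound n e a y h
  ... | true with ∨-true⁻¹ {hd s ≡ᵇ judgement n e a y} (trans (sym (testBit-insertSet (hd s) db _)) h)
  ...   | inj₂ old = sound n e a y old
  ...   | inj₁ new = rule-sound n e a y (hd (tl s)) (trans (sym (ruleAt-judgement db n e a y _))
    (trans (cong (λ j → ruleAt db j (hd (tl s))) (sym (≡ᵇ-true⁻¹ {hd s} new))) eq))

derived-sound : ∀ s → Sound (derived s)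
derived-sound zero n e a y h = ⊥-elim (true≢false h (testBit-0 (judgement n e a y)))
derived-sound (suc s) = extend-sound (derived-sound s) s

testBit-extend : ∀ s db j → testBit db j ≡ true → testBit (extend s db) j ≡ true
testBit-extend s db j h with ruleAt db (hd s) (hd (tl s))
... | false = h
... | true  = trans (testBit-insertSet (hd s) db j) (trans (cong ((hd s ≡ᵇ j) ∨_) h) (∨-zeroʳ (hd s ≡ᵇ j)))

derived-mono : ∀ {s t} j → s ≤ t → testBit (derived s) j ≡ true → testBit (derived t) j ≡ true
derived-mono {s} {zero} j z≤n h = h
derived-mono {s} {suc t} j s≤t h with m≤n⇒m<n∨m≡n s≤t
... | inj₁ (s≤s le) = testBit-extend t (derived t) j (derived-mono j le h)
... | inj₂ refl     = h

Holds : (n e a y : ℕ) → Set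
Holds n e a y = Eventually λ s → holds (derived s) n e a y ≡ true

-- With `s₀` as padding, the stage that tries `j` with `w` is at least `s₀`, so the rule already
-- applies there.
infer : ∀ n e a y w → Eventually (λ s → rule (derived s) n e a y w ≡ true) → Holds n e a y
infer n e a y w (s₀ , h) = suc s , λ t le → derived-mono {suc s} {t} j le
  (step (hd-pair j _) (trans (cong hd (tl-pair j _)) (hd-pair w s₀))
        (h s (≤-trans (y≤pair w s₀) (y≤pair j (pair w s₀)))))
  where
  j = judgement n e a y
  s = pair j (pair w s₀)
  step : ∀ {db u v} → u ≡ j → v ≡ w → rule db n e a y w ≡ true →
    testBit (if ruleAt db u v then insertSet u db else db) j ≡ true
  step {db} refl refl ok rewrite trans (ruleAt-judgement db n e a y w) ok =
    trans (testBit-insertSet j db j) (cong (_∨ testBit db j) (≡ᵇ-true j))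

opaque
  unfolding rule

  infer-ruleT : ∀ {n e a y} t r w → e % 6 ≡ t → e / 6 ≡ r →
    Eventually (λ s → ruleT t r (derived s) n e a y w ≡ true) → Holds n e a y
  infer-ruleT {n} {e} {a} {y} t r w refl refl = infer n e a y w

∧-true : ∀ {b c} → b ≡ true → c ≡ true → b ∧ c ≡ true
∧-true refl refl = refl

mutual
  -- The recursion is on the derivation, since the predecessor case of `prec` keeps both program and
  -- fuel. Number and program are linked by an equation only, which leaves `p` a variable to match
  -- against.
  complete : ∀ {n p xs y} → p ⊢ xs ⇓ y → ∀ f e → e < f → p ≡ dec f n e → Holds n e (vcode xs) y
  complete d (suc f) e (s≤s e≤f) eq =
    completeT d f e (e % 6) (e / 6) refl refl (λ k eq → ≤-trans (quotient< {e} eq) e≤f) eq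

  completeT : ∀ {n p xs y} → p ⊢ xs ⇓ y → ∀ f e t r → e % 6 ≡ t → e / 6 ≡ r →
    (∀ k → t ≡ suc k → r < f) → p ≡ decT f n t r → Holds n e (vcode xs) y
  completeT ev-zer f e 0 r et er bound refl = infer-ruleT 0 r 0 et er (always λ _ → refl)
  completeT {0} ev-zer f e 1 r et er bound refl = infer-ruleT 1 r 0 et er (always λ _ → refl)
  completeT {1} d f e 1 r et er bound eq with eq
  completeT {1} (ev-succ {x}) f e 1 r et er bound eq | refl = infer-ruleT 1 r 0 et er
    (always λ _ → trans (cong (λ z → suc x ≡ᵇ suc z) (hd-pair x 0)) (≡ᵇ-true (suc x)))
  completeT {suc (suc n)} ev-zer f e 1 r et er bound refl = infer-ruleT 1 r 0 et er (always λ _ → refl)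
  completeT {0} ev-zer f e 2 r et er bound refl = infer-ruleT 2 r 0 et er (always λ _ → refl)
  completeT {suc n} d f e 2 r et er bound eq with trans eq (decT-proj f n r)
  completeT {suc n} (ev-proj {xs = xs}) f e 2 r et er bound eq | refl =
    infer-ruleT 2 r 0 et er (always λ _ →
      trans (cong (lookup xs i ≡ᵇ_) (trans (cong (nth (vcode xs)) (sym (toℕ-mod r n))) (nth-vcode xs i)))
            (≡ᵇ-true (lookup xs i)))
    where i = r mod suc n
  completeT {n} d f e 3 r et er bound eq with trans eq (decT-comp f n r)
  completeT {n} (ev-comp {ys = ys} ds d) f e 3 r et er bound eq | refl =
    infer-ruleT 3 r (vcode ys) et er (ev-map₂ (λ s h h* → ∧-true h (all<-true _ h*))
      (complete d f _ (≤-<-trans (≤-trans (tl≤ (hd r)) (hd≤ r)) (bound 2 refl)) refl)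
      (complete* ds f (tl r) (≤-<-trans (tl≤ r) (bound 2 refl)) refl))
  completeT {0} ev-zer f e 4 r et er bound refl = infer-ruleT 4 r 0 et er (always λ _ → refl)
  completeT {suc n} d f e 4 r et er bound eq with trans eq (decT-prec f n r)
  completeT {suc n} (ev-prec0 {xs = xs} {z = z} d) f e 4 r et er bound eq | refl =
    infer-ruleT 4 r 0 et er (ev-map (λ s h → zero-case (hd-pair 0 (vcode xs)) (tl-pair 0 (vcode xs)) h)
      (complete d f (hd r) (≤-<-trans (hd≤ r) (bound 3 refl)) refl))
    where
    zero-case : ∀ {db x b} {c : Bool} → x ≡ 0 → b ≡ vcode xs → holds db n (hd r) (vcode xs) z ≡ true →
      (if x ≡ᵇ 0 then holds db n (hd r) b z else c) ≡ true
    zero-case refl refl h = h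
  completeT {suc n} (ev-precS {k = k} {xs = xs} {y = w} {z = z} d d′) f e 4 r et er bound eq | refl =
    infer-ruleT 4 r w et er (ev-map₂ (λ s h h′ → suc-case (hd-pair (suc k) _) (tl-pair (suc k) _) (∧-true h h′))
      (completeT d f e 4 r et er bound (sym (decT-prec f n r)))
      (complete d′ f (tl r) (≤-<-trans (tl≤ r) (bound 3 refl)) refl))
    where
    suc-case : ∀ {db x b} {c : Bool} → x ≡ suc k → b ≡ vcode xs →
      holds db (suc n) e (pair k (vcode xs)) w ∧
      holds db (suc (suc n)) (tl r) (pair k (pair w (vcode xs))) z ≡ true →
      (if x ≡ᵇ 0 then c else holds db (suc n) e (pair (pred x) b) w ∧
      holds db (suc (suc n)) (tl r) (pair (pred x) (pair w b)) z) ≡ true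
    suc-case refl refl h = h
  completeT {n} d f e (suc (suc (suc (suc (suc t))))) r et er bound eq with trans eq (decT-mu f n t r)
  completeT {n} (ev-mu {xs = xs} {k = k} d ds) f e (suc (suc (suc (suc (suc t))))) r et er bound eq | refl =
    infer-ruleT (5 + t) r w et er (ev-map₂ (λ s h h* → ∧-true h (all<-true k h*))
      (complete d f r (bound _ refl) refl)
      (ev-∀< k below))
    where
    -- Values are known only below `k`; the 0 elsewhere is a filler that makes the function total.
    predecessor : ℕ → ℕ
    predecessor j with j <? k
    ... | yes lt = proj₁ (ds j lt)
    ... | no _   = 0
    w = tabulateℕ predecessor k
    below : ∀ j → j < k → Holds (suc n) r (pair j (vcode xs)) (suc (nth w j))
    below j lt rewrite nth-tabulateℕ predecessor k j lt with j <? k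
    ... | no ¬lt = ⊥-elim (¬lt lt)
    ... | yes lt′ with ds j lt′
    ...   | m , d′ = complete d′ f r (bound _ refl) refl

  complete* : ∀ {n m ps xs ys} → ps ⊢* xs ⇓ ys → ∀ f b → b < f → ps ≡ decVec f n m b →
    Eventually (λ s → ∀ i → i < m → holds (derived s) n (nth b i) (vcode xs) (nth (vcode ys) i) ≡ true)
  complete* ev-[] f b b<f refl = always λ _ _ ()
  complete* {n} {suc m} {xs = xs} (ev-∷ {y = y} {ys = ys} d ds) f b b<f refl = ev-map₂ merge
    (complete d f (hd b) (≤-<-trans (hd≤ b) b<f) refl)
    (complete* ds f (tl b) (≤-<-trans (tl≤ b) b<f) refl)
    where
    merge : ∀ s → holds (derived s) n (hd b) (vcode xs) y ≡ true →
      (∀ i → i < m → holds (derived s) n (nth (tl b) i) (vcode xs) (nth (vcode ys) i) ≡ true) →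
      ∀ i → i < suc m → holds (derived s) n (nth b i) (vcode xs) (nth (pair y (vcode ys)) i) ≡ true
    merge s h h* zero    _        rewrite hd-pair y (vcode ys) = h
    merge s h h* (suc i) (s≤s lt) rewrite tl-pair y (vcode ys) = h* i lt

holdsᶜ : ∀ {m} {a b c d e : Vec ℕ m → ℕ} → Computable a → Computable b → Computable c →
  Computable d → Computable e → Computableᵇ (λ ρ → holds (a ρ) (b ρ) (c ρ) (d ρ) (e ρ))
holdsᶜ ca cb cc cd ce = testBitᶜ ca (judgementᶜ cb cc cd ce)

opaque
  unfolding rule
  ruleᶜ : ∀ {m} {db n e a y w : Vec ℕ m → ℕ} → Computable db → Computable n → Computable e →
    Computable a → Computable y → Computable w →
    Computableᵇ (λ ρ → rule (db ρ) (n ρ) (e ρ) (a ρ) (y ρ) (w ρ))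
  ruleᶜ {m} {db} {n} {e} {a} {y} {w} cdb cn ce ca cy cw =
    ifᵇᶜ (ct ≡ᵇᶜ constᶜ 0) (cy ≡ᵇᶜ constᶜ 0)
    (ifᵇᶜ (ct ≡ᵇᶜ constᶜ 1) (ifᵇᶜ (cn ≡ᵇᶜ constᶜ 1) (cy ≡ᵇᶜ sucᶜ (hdᶜ ca)) (cy ≡ᵇᶜ constᶜ 0))
    (ifᵇᶜ (ct ≡ᵇᶜ constᶜ 2)
      (ifᵇᶜ (cn ≡ᵇᶜ constᶜ 0) (cy ≡ᵇᶜ constᶜ 0) (cy ≡ᵇᶜ nthᶜ ca (cr %ᶜ predᶜ cn)))
    (ifᵇᶜ (ct ≡ᵇᶜ constᶜ 3)
      (holdsᶜ cdb (hdᶜ (hdᶜ cr)) (tlᶜ (hdᶜ cr)) cw cy ∧ᶜ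
       all<ᶜ {P = λ i ρ → holds (db ρ) (n ρ) (nth (tl (e ρ / 6)) i) (a ρ) (nth (w ρ) i)} (hdᶜ (hdᶜ cr))
         (holdsᶜ (wk cdb) (wk cn) (nthᶜ (tlᶜ (wk cr)) v₀) (wk ca) (nthᶜ (wk cw) v₀)))
    (ifᵇᶜ (ct ≡ᵇᶜ constᶜ 4)
      (ifᵇᶜ (cn ≡ᵇᶜ constᶜ 0) (cy ≡ᵇᶜ constᶜ 0)
        (ifᵇᶜ (hdᶜ ca ≡ᵇᶜ constᶜ 0) (holdsᶜ cdb (predᶜ cn) (hdᶜ cr) (tlᶜ ca) cy)
          (holdsᶜ cdb cn ce (pairᶜ (predᶜ (hdᶜ ca)) (tlᶜ ca)) cw ∧ᶜ
           holdsᶜ cdb (sucᶜ cn) (tlᶜ cr) (pairᶜ (predᶜ (hdᶜ ca)) (pairᶜ cw (tlᶜ ca))) cy)))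
      (holdsᶜ cdb (sucᶜ cn) cr (pairᶜ cy ca) (constᶜ 0) ∧ᶜ
       all<ᶜ {P = λ j ρ → holds (db ρ) (suc (n ρ)) (e ρ / 6) (pair j (a ρ)) (suc (nth (w ρ) j))} cy
         (holdsᶜ (wk cdb) (sucᶜ (wk cn)) (wk cr) (pairᶜ v₀ (wk ca)) (sucᶜ (nthᶜ (wk cw) v₀))))))))
    where
    ct : Computable (λ ρ → e ρ % 6)
    ct = ce %ᶜ constᶜ 5
    cr : Computable (λ ρ → e ρ / 6)
    cr = ce /ᶜ constᶜ 5

derivedᶜ : Computable₁ derived
derivedᶜ {a = a} ca = natrecᶜ {s = λ s db _ → extend s db} (constᶜ 0)
  (ifᶜ (ruleᶜ cdb (arityOfᶜ cj) (programOfᶜ cj) (argsOfᶜ cj) (valueOfᶜ cj) (hdᶜ (tlᶜ v₀)))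
       (insertSetᶜ cj cdb) cdb) ca
  where
  cdb = wk v₀
  cj = hdᶜ v₀

opaque

  evaluates : (s e x y : ℕ) → Bool
  evaluates s e x y = holds (derived s) 1 e (pair x 0) y

  evaluatesᶜ : ∀ {m} {a b c d : Vec ℕ m → ℕ} → Computable a → Computable b → Computable c → Computable d →
    Computableᵇ (λ ρ → evaluates (a ρ) (b ρ) (c ρ) (d ρ))
  evaluatesᶜ ca cb cc cd = holdsᶜ (derivedᶜ ca) (constᶜ 1) cb (pairᶜ cc (constᶜ 0)) cd

  evaluates-sound : ∀ s e x y → evaluates s e x y ≡ true → φ e ⟨ x ⟩⇓ y
  evaluates-sound s e x y h = subst (λ v → program e ⊢ v ∷ [] ⇓ y) (hd-pair x 0)
    (derived-sound s 1 e (pair x 0) y h)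

  evaluates-complete : ∀ e x y → φ e ⟨ x ⟩⇓ y → Eventually (λ s → evaluates s e x y ≡ true)
  evaluates-complete e x y d = complete d (suc e) e ≤-refl refl

-- The learner on finite sets

-- w codes a finite sequence of symbols, continued by an enumeration of ℕ that
-- hits every number infinitely often; cand w P erases the elements outside P.
rawSymbol : ℕ → ℕ → ℕ
rawSymbol w i = if i <ᵇ hd w then nth (tl w) i else suc (hd i)

symbol : ℕ → (ℕ → Bool) → ℕ → ℕ
-- A pause tests `P 0`, because `pred 0` is 0, but both branches then give the pause again.
symbol w P i = if P (pred (rawSymbol w i)) then rawSymbol w i else 0

decSym : ℕ → Maybe ℕ
decSym zero    = nothing
decSym (suc x) = just x

opaque
  cand : ℕ → (ℕ → Bool) → Text
  cand w P i = decSym (symbol w P i)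

-- The stored length serves twice: it ends the listed part, and in `stable` it is the time from
-- which `g` may no longer change.
listing : (ℕ → ℕ) → ℕ → ℕ
listing f n = pair n (tabulateℕ f n)

encSym-decSym : ∀ k → encSym (decSym k) ≡ k
encSym-decSym zero    = refl
encSym-decSym (suc k) = refl

decSym-just : ∀ {k x} → decSym k ≡ just x → k ≡ suc x
decSym-just {suc k} refl = refl

rawSymbol-≥ : ∀ {w i} → hd w ≤ i → rawSymbol w i ≡ suc (hd i)
rawSymbol-≥ {w} {i} le rewrite <ᵇ-false le = refl

rawSymbol-listing-< : ∀ f {n i} → i < n → rawSymbol (listing f n) i ≡ f i
rawSymbol-listing-< f {n} {i} lt rewrite hd-pair n (tabulateℕ f n) | <ᵇ-true lt
  | tl-pair n (tabulateℕ f n) = nth-tabulateℕ f n i lt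

rawSymbol-listing-≥ : ∀ f {n i} → n ≤ i → rawSymbol (listing f n) i ≡ suc (hd i)
rawSymbol-listing-≥ f {n} le = rawSymbol-≥ {listing f n} (subst (_≤ _) (sym (hd-pair n (tabulateℕ f n))) le)

opaque
  unfolding cand

  cand-sound : ∀ w P i {x} → cand w P i ≡ just x → P x ≡ true
  cand-sound w P i {x} eq with P (pred (rawSymbol w i)) in p
  ... | true = subst (λ k → P (pred k) ≡ true) (decSym-just {rawSymbol w i} eq) p

  cand-complete : ∀ w P {x k} → P x ≡ true → hd w ≤ k → cand w P (pair x k) ≡ just x
  cand-complete w P {x} {k} p le rewrite rawSymbol-≥ {w} (≤-trans le (y≤pair x k)) | hd-pair x k | p = refl

  cand-cong : ∀ w P Q i → P (pred (rawSymbol w i)) ≡ Q (pred (rawSymbol w i)) → cand w P i ≡ cand w Q i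
  cand-cong w P Q i eq rewrite eq = refl

  cand-listing : ∀ X {P n i} → (∀ {x} → X i ≡ just x → P x ≡ true) → i < n →
    cand (listing (encSym ∘ X) n) P i ≡ X i
  cand-listing X {P} {n} {i} sub lt rewrite rawSymbol-listing-< (encSym ∘ X) lt with X i
  ... | just x rewrite sub refl = refl
  ... | nothing with P 0
  ...   | true  = refl
  ...   | false = refl

  -- Listing the beginning of the enumeration itself alters no symbol; it only postpones the time
  -- from which stability counts.
  cand-canonical : ∀ n P i → cand (listing (suc ∘ hd) n) P i ≡ cand 0 P i
  cand-canonical n P i with i <? n
  ... | yes lt rewrite rawSymbol-listing-< (suc ∘ hd) lt = refl
  ... | no ≮  rewrite rawSymbol-listing-≥ (suc ∘ hd) (≮⇒≥ ≮) = refl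

bit-injective : ∀ {b c} → bit b ≡ bit c → b ≡ c
bit-injective {true}  {true}  _ = refl
bit-injective {false} {false} _ = refl

IsText : (ℕ → Bool) → Text → Set
IsText χ X = (∀ i {x} → X i ≡ just x → χ x ≡ true) × (∀ {x} → χ x ≡ true → content X x)

cand-isText : ∀ w χ → IsText χ (cand w χ)
cand-isText w χ = cand-sound w χ , λ p → _ , cand-complete w χ p ≤-refl

module Learner (g : Text → ℕ → ℕ) (g-cong : ∀ {X Y} n → (∀ i → i < n → X i ≡ Y i) → g X n ≡ g Y n) where

  stable : ℕ → (ℕ → Bool) → ℕ → Bool
  stable w P t = all< (suc t) λ n → (n <ᵇ hd w) ∨ (g (cand w P) n ≡ᵇ g (cand w P) (hd w))

  guess : (ℕ → Bool) → ℕ → ℕ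
  guess P t = g (cand w P) (hd w)
    where w = least (λ w → stable w P t) t

  -- The search stops at a wrong value and also at one not yet seen within `t` steps, so it makes
  -- sense even when the guess is no `C`-index.
  agreement : (ℕ → Bool) → ℕ → ℕ
  agreement P t = least (λ i → not (evaluates t (guess P t) i (bit (P i)))) t

  -- The cut-off may vary with time. This is harmless once it exceeds the convergence point of `g`
  -- on the canonical text and the symbols before it are correct.
  output : (ℕ → Bool) → ℕ → ℕ
  output P t = g (cand 0 P) (agreement P t)

  stable-true : ∀ {w P t} → (∀ n → hd w ≤ n → n ≤ t → g (cand w P) n ≡ g (cand w P) (hd w)) → stable w P t ≡ true
  stable-true {w} {P} {t} h = all<-true (suc t) λ { n (s≤s n≤t) → at n n≤t }
    where
    at : ∀ n → n ≤ t → (n <ᵇ hd w) ∨ (g (cand w P) n ≡ᵇ g (cand w P) (hd w)) ≡ true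
    at n n≤t with n <? hd w
    ... | yes lt rewrite <ᵇ-true lt = refl
    ... | no ≮  rewrite h n (≮⇒≥ ≮) n≤t | ≡ᵇ-true (g (cand w P) (hd w)) = ∨-zeroʳ (n <ᵇ hd w)

  stable-true⁻¹ : ∀ {w P t} → stable w P t ≡ true → ∀ n → hd w ≤ n → n ≤ t → g (cand w P) n ≡ g (cand w P) (hd w)
  stable-true⁻¹ {w} {P} {t} h n le n≤t with ∨-true⁻¹ {n <ᵇ hd w} (all<-true⁻¹ (suc t) h n (s≤s n≤t))
  ... | inj₁ lt = ⊥-elim (<⇒≱ (<ᵇ-true⁻¹ lt) le)
  ... | inj₂ eq = ≡ᵇ-true⁻¹ {g (cand w P) n} eq

  -- Convergence of the learner on a text for a decidable language

  module Convergence
    (χ : ℕ → Bool)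
    (P : ℕ → ℕ → Bool)
    (P-sound : ∀ t {x} → P t x ≡ true → χ x ≡ true)
    (P-limit : ∀ x → Eventually λ t → P t x ≡ χ x)
    (limit : ∀ X → IsText χ X → Σ ℕ λ c → Eventually λ n → g X n ≡ c)
    where

    approximates : ∀ w n → Eventually λ t → ∀ i → i < n → cand w (P t) i ≡ cand w χ i
    approximates w n = ev-∀< n λ i _ → ev-map (λ t → cand-cong w (P t) χ i) (P-limit (pred (rawSymbol w i)))

    T̂ : Text
    T̂ = cand 0 χ

    T̂-limit = limit T̂ (cand-isText 0 χ)
    c₀ = proj₁ T̂-limit
    n₀ = proj₁ (proj₂ T̂-limit)

    -- A monotone modulus: from time `τ n` on, the first `n` symbols of the canonical text of `P t`
    -- are final.
    τ : ℕ → ℕ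
    τ zero    = 0
    τ (suc i) = τ i ⊔ proj₁ (approximates 0 (suc i))

    τ-mono : ∀ {i j} → i ≤ j → τ i ≤ τ j
    τ-mono {zero}  _         = z≤n
    τ-mono {suc i} {suc j} le with m≤n⇒m<n∨m≡n le
    ... | inj₂ refl     = ≤-refl
    ... | inj₁ (s≤s lt) = ≤-trans (τ-mono lt) (m≤m⊔n (τ j) _)

    τ-agree : ∀ t i → τ (suc i) ≤ t → cand 0 (P t) i ≡ T̂ i
    τ-agree t i le = proj₂ (approximates 0 (suc i)) t (≤-trans (m≤n⊔m (τ i) _) le) i ≤-refl

    Bad : ℕ → Set
    Bad N = Σ ℕ λ t → Σ ℕ λ n → N ≤ t × n₀ ≤ n × ¬ g (cand 0 (P t)) n ≡ c₀

    -- Ishihara's trick: the text Z follows T̂ and deviates into a bad sequence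
    -- once b turns true; the point where g settles on Z bounds the search for
    -- such a turn.
    module Explore (b : ℕ → Bool) (bad : ∀ N → b N ≡ true → Bad N) where

      probe : ∀ k v → b k ≡ v → Maybe (Σ ℕ λ N → b N ≡ true)
      probe k true  eq = just (k , eq)
      probe k false eq = nothing

      probe-nothing : ∀ k v eq → probe k v eq ≡ nothing → v ≡ false
      probe-nothing k false eq _ = refl

      first : ℕ → Maybe (Σ ℕ λ N → b N ≡ true)
      first zero    = nothing
      first (suc k) = first k <∣> probe k (b k) refl

      first-mono : ∀ {k l s} → k ≤ l → first k ≡ just s → first l ≡ just s
      first-mono {k} {l} k≤l eq with m≤n⇒m<n∨m≡n k≤l
      ... | inj₂ refl = eq
      first-mono {k} {suc l} k≤l eq | inj₁ (s≤s k≤l′) rewrite first-mono k≤l′ eq = refl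

      first-nothing : ∀ k → first k ≡ nothing → ∀ N → N < k → b N ≡ false
      first-nothing (suc k) eq N (s≤s N≤k) with first k in e
      ... | nothing with m≤n⇒m<n∨m≡n N≤k
      ...   | inj₁ N<k  = first-nothing k e N N<k
      ...   | inj₂ refl = probe-nothing N (b N) refl eq

      first-unique : ∀ k l {s s′} → first k ≡ just s → first l ≡ just s′ → s ≡ s′
      first-unique k l p q with ≤-total k l
      ... | inj₁ k≤l with refl ← trans (sym (first-mono k≤l p)) q = refl
      ... | inj₂ l≤k with refl ← trans (sym (first-mono l≤k q)) p = refl

      -- The deviation is finite and, by `P-sound`, stays inside the language, so the result is a
      -- text whatever `b` does.
      deviate : ∀ i → Maybe (Σ ℕ λ N → b N ≡ true) → Maybe ℕ
      deviate i nothing = T̂ i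
      deviate i (just (N , p)) with bad N p
      ... | t , n , _ = if i <ᵇ n then cand 0 (P t) i else T̂ i

      -- Symbol `i` consults `b` only below `τ (suc i)`. A witness found later has a bad time at
      -- least that large, for which symbol `i` is already final. Thus the symbols emitted before
      -- the discovery fit the bad sequence, and `Z` begins with all of it.
      Z : Text
      Z i = deviate i (first (τ (suc i)))

      deviate-sound : ∀ i s {x} → deviate i s ≡ just x → χ x ≡ true
      deviate-sound i nothing eq = cand-sound 0 χ i eq
      deviate-sound i (just (N , p)) eq with bad N p
      ... | t , n , _ with i <ᵇ n
      ...   | true  = P-sound t (cand-sound 0 (P t) i eq)
      ...   | false = cand-sound 0 χ i eq

      deviate-≥ : ∀ i N p → proj₁ (proj₂ (bad N p)) ≤ i → deviate i (just (N , p)) ≡ T̂ i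
      deviate-≥ i N p le rewrite <ᵇ-false le = refl

      Z-isText : IsText χ Z
      Z-isText = (λ i → deviate-sound i (first (τ (suc i)))) , complete-Z
        where
        complete-Z : ∀ {x} → χ x ≡ true → content Z x
        complete-Z {x} p with first (τ (suc (pair x 0))) in eq
        ... | nothing = pair x 0 , trans (cong (deviate (pair x 0)) eq) (cand-complete 0 χ p z≤n)
        ... | just (N , q) = i′ , trans
          (cong (deviate i′) (first-mono (τ-mono (s≤s (≤-trans (m≤n+m i n) (y≤pair x (n + i))))) eq))
          (trans (deviate-≥ i′ N q (≤-trans (m≤m+n n i) (y≤pair x (n + i)))) (cand-complete 0 χ p z≤n))
          where
          i = pair x 0
          n = proj₁ (proj₂ (bad N q))
          -- An occurrence of `x` beyond the end `n` of the deviation and no earlier than `i`, where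
          -- the witness is already known.
          i′ = pair x (n + i)

      M = proj₁ (proj₂ (limit Z Z-isText)) ⊔ n₀

      -- Without a witness below `τ M`, the texts `Z` and `T̂` share `M` symbols, so `g` settles on
      -- `Z` at `c₀` as well. A later witness would make `g` differ from `c₀` on a prefix of `Z` of
      -- some length at least `n₀`: below `M` this contradicts convergence on `T̂`, from `M` on it
      -- contradicts convergence on `Z`.
      search : (Σ ℕ λ N → b N ≡ true) ⊎ (∀ N → b N ≡ false)
      search with first (τ M) in eq
      ... | just s  = inj₁ s
      ... | nothing = inj₂ never
        where
        Z-T̂ : ∀ i → i < M → Z i ≡ T̂ i
        Z-T̂ i lt with first (τ (suc i)) in e
        ... | nothing = refl
        ... | just s with () ← trans (sym (first-mono (τ-mono lt) e)) eq

        settled : ∀ n → M ≤ n → g Z n ≡ c₀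
        settled n le = trans (at n le) (trans (sym (at M ≤-refl))
          (trans (g-cong M Z-T̂) (proj₂ (proj₂ T̂-limit) M (m≤n⊔m _ n₀))))
          where
          at : ∀ n → M ≤ n → g Z n ≡ proj₁ (limit Z Z-isText)
          at n le = proj₂ (proj₂ (limit Z Z-isText)) n (≤-trans (m≤m⊔n _ n₀) le)

        never : ∀ N → b N ≡ false
        never N with b N in e
        ... | false = refl
        ... | true with first (suc N) in f
        ...   | nothing = ⊥-elim (true≢false e (first-nothing (suc N) f N ≤-refl))
        ...   | just (N′ , p) with bad N′ p in bd
        ...     | t , n , N′≤t , n₀≤n , differs = ⊥-elim (differs (trans (sym g≡) g-Z))
          where
          late : ∀ k → first k ≡ nothing → k ≤ t
          late k none = ≤-trans (≮⇒≥ λ lt → true≢false p (first-nothing k none N′ lt)) N′≤t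

          Z-bad : ∀ i → i < n → Z i ≡ cand 0 (P t) i
          Z-bad i lt with first (τ (suc i)) in e′
          ... | nothing = sym (τ-agree t i (late (τ (suc i)) e′))
          ... | just s with refl ← first-unique (τ (suc i)) (suc N) e′ f rewrite bd | <ᵇ-true lt = refl

          g≡ : g Z n ≡ g (cand 0 (P t)) n
          g≡ = g-cong n Z-bad

          g-Z : g Z n ≡ c₀
          g-Z with n <? M
          ... | no ≮ = settled n (≮⇒≥ ≮)
          ... | yes lt = trans (g-cong n λ i i<n → Z-T̂ i (<-trans i<n lt)) (proj₂ (proj₂ T̂-limit) n n₀≤n)

    explore : ∀ b → (∀ N → b N ≡ true → Bad N) → (Σ ℕ λ N → b N ≡ true) ⊎ (∀ N → b N ≡ false)
    explore b bad = Explore.search b bad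

    bad? : ℕ → Bool
    bad? t = not (all< (suc t) λ n → (n <ᵇ n₀) ∨ (g (cand 0 (P t)) n ≡ᵇ c₀))

    not-true⁻¹ : ∀ {b} → not b ≡ true → b ≡ false
    not-true⁻¹ {false} _ = refl

    not-false⁻¹ : ∀ {b} → not b ≡ false → b ≡ true
    not-false⁻¹ {true} _ = refl

    bad?-sound : ∀ {N t} → N ≤ t → bad? t ≡ true → Bad N
    bad?-sound {N} {t} N≤t h with all<-false⁻¹ (suc t) (not-true⁻¹ h)
    ... | n , _ , q with n <ᵇ n₀ in e
    ...   | false = t , n , N≤t , ≮⇒≥ (λ lt → true≢false (<ᵇ-true lt) e) ,
      λ eq → true≢false (trans (cong (_≡ᵇ c₀) eq) (≡ᵇ-true c₀)) q

    Recurrent Finished : ℕ → Set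
    Recurrent N = Σ ℕ λ t → N ≤ t × bad? t ≡ true
    Finished N  = ∀ t → N ≤ t → bad? t ≡ false

    recurrent? : ∀ N → Recurrent N ⊎ Finished N
    recurrent? N with explore (λ k → bad? (N + k)) (λ k → bad?-sound (m≤n+m k N))
    ... | inj₁ (k , h) = inj₁ (N + k , m≤m+n N k , h)
    ... | inj₂ none    = inj₂ λ t N≤t → subst (λ t → bad? t ≡ false) (m+[n∸m]≡n N≤t) (none (t ∸ N))

    LPO : Set
    LPO = ∀ (b : ℕ → Bool) → (Σ ℕ λ N → b N ≡ true) ⊎ (∀ N → b N ≡ false)

    -- True exactly at the last bad time, if there is one. Being itself bad, that time can be
    -- searched for by `explore`.
    isLast : ∀ {N} → Recurrent N ⊎ Finished N → Recurrent (suc N) ⊎ Finished (suc N) → Bool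
    isLast (inj₁ _) (inj₂ _) = true
    isLast (inj₁ _) (inj₁ _) = false
    isLast (inj₂ _) _        = false

    isLast-bad : ∀ {N} (r : Recurrent N ⊎ Finished N) r′ → isLast r r′ ≡ true → Bad N
    isLast-bad (inj₁ (t , N≤t , q)) _ _ = bad?-sound N≤t q

    isLast-finished : ∀ {N} (r : Recurrent N ⊎ Finished N) r′ → isLast r r′ ≡ true → Finished (suc N)
    isLast-finished (inj₁ _) (inj₂ h) _ = h

    isLast-next : ∀ {N} (r : Recurrent N ⊎ Finished N) r′ → isLast r r′ ≡ false → Recurrent N → Recurrent (suc N)
    isLast-next (inj₁ _) (inj₁ r) _ _ = r
    isLast-next (inj₂ h) _ _ (t , N≤t , q) = ⊥-elim (true≢false q (h t N≤t))

    -- If bad times occur but none is the last, they recur after every `N`. Then `Bad N` holds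
    -- outright, the side condition of `explore` is met by every `b`, and `explore` becomes
    -- omniscience.
    finished-or-LPO : Eventually (λ t → bad? t ≡ false) ⊎ LPO
    finished-or-LPO with recurrent? 0
    ... | inj₂ h  = inj₁ (0 , h)
    ... | inj₁ r₀ with explore (λ N → isLast (recurrent? N) (recurrent? (suc N)))
                               (λ N → isLast-bad (recurrent? N) (recurrent? (suc N)))
    ...   | inj₁ (N , last) = inj₁ (suc N , isLast-finished (recurrent? N) (recurrent? (suc N)) last)
    ...   | inj₂ none = inj₂ λ b → explore b λ N _ → recurrent-bad (recurrent N)
      where
      recurrent : ∀ N → Recurrent N
      recurrent zero    = r₀
      recurrent (suc N) = isLast-next (recurrent? N) (recurrent? (suc N)) (none N) (recurrent N)
      recurrent-bad : ∀ {N} → Recurrent N → Bad N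
      recurrent-bad (t , N≤t , q) = bad?-sound N≤t q

    EventuallyStable : Set
    EventuallyStable = Σ ℕ λ w → Eventually λ t → stable w (P t) t ≡ true

    finished⇒stable : Eventually (λ t → bad? t ≡ false) → EventuallyStable
    finished⇒stable finished = w , ev-map₂ at finished (eventually-≥ n₀)
      where
      w = listing (suc ∘ hd) n₀
      hd-w : hd w ≡ n₀
      hd-w = hd-pair n₀ (tabulateℕ (suc ∘ hd) n₀)
      at : ∀ t → bad? t ≡ false → n₀ ≤ t → stable w (P t) t ≡ true
      at t fine n₀≤t = stable-true λ n le n≤t →
        trans (value n (subst (_≤ n) hd-w le) n≤t)
              (sym (value (hd w) (≤-reflexive (sym hd-w)) (subst (_≤ t) (sym hd-w) n₀≤t)))
        where
        value : ∀ n → n₀ ≤ n → n ≤ t → g (cand w (P t)) n ≡ c₀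
        value n le n≤t with ∨-true⁻¹ {n <ᵇ n₀} (all<-true⁻¹ (suc t) (not-false⁻¹ fine) n (s≤s n≤t))
        ... | inj₁ lt = ⊥-elim (<⇒≱ (<ᵇ-true⁻¹ lt) le)
        ... | inj₂ eq = trans (g-cong n λ i _ → cand-canonical n₀ (P t) i) (≡ᵇ-true⁻¹ {g (cand 0 (P t)) n} eq)

    module Locking (lpo : LPO) where

      -- k codes a sequence cand w′ χ of length n′ that extends the first n
      -- symbols of cand w χ and on which g differs.
      refutes : (w n k : ℕ) → Bool
      refutes w n k = (n <ᵇ suc n′) ∧
        (all< n (λ i → encSym (cand w′ χ i) ≡ᵇ encSym (cand w χ i)) ∧
         not (g (cand w′ χ) n′ ≡ᵇ g (cand w χ) n))
        where
        w′ = hd k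
        n′ = tl k

      Refutable Locked : ℕ → ℕ → Set
      Refutable w n = Σ ℕ λ k → refutes w n k ≡ true
      Locked w n = ∀ k → refutes w n k ≡ false

      -- The prefix is lengthened to list k if k is in the language, so that the
      -- limit of the states is a text for it.
      next : ∀ k w n → Refutable w n ⊎ Locked w n → ℕ × ℕ
      next k w n (inj₁ (l , _)) = hd l , tl l + n + suc (pair k (hd (hd l)))
      next k w n (inj₂ _)       = w , n + suc (pair k (hd w))

      state : ℕ → ℕ × ℕ
      state zero    = 0 , 0
      state (suc k) = next k (proj₁ (state k)) (proj₂ (state k))
        (lpo (refutes (proj₁ (state k)) (proj₂ (state k))))

      seqOf lenOf : ℕ → ℕ
      seqOf k = proj₁ (state k)
      lenOf k = proj₂ (state k)

      encSym-injective : ∀ {s t} → encSym s ≡ encSym t → s ≡ t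
      encSym-injective {just x} {just .x} refl = refl
      encSym-injective {nothing} {nothing} refl = refl

      refutes-true⁻¹ : ∀ w n k → refutes w n k ≡ true →
        n ≤ tl k × (∀ i → i < n → cand (hd k) χ i ≡ cand w χ i) × ¬ g (cand (hd k) χ) (tl k) ≡ g (cand w χ) n
      refutes-true⁻¹ w n k h with ∧-true⁻¹ {n <ᵇ suc (tl k)} h
      ... | h₁ , h₂₃ with ∧-true⁻¹ h₂₃
      ...   | h₂ , h₃ = ≤-pred (<ᵇ-true⁻¹ h₁) ,
        (λ i lt → encSym-injective (≡ᵇ-true⁻¹ (all<-true⁻¹ n h₂ i lt))) ,
        λ eq → true≢false (trans (cong (_≡ᵇ g (cand w χ) n) eq) (≡ᵇ-true (g (cand w χ) n))) (not-true⁻¹ h₃)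

      locked⇒≡ : ∀ w n → Locked w n → ∀ w′ n′ → n ≤ n′ → (∀ i → i < n → cand w′ χ i ≡ cand w χ i) →
        g (cand w′ χ) n′ ≡ g (cand w χ) n
      locked⇒≡ w n locked w′ n′ n≤n′ agree with g (cand w′ χ) n′ ≟ g (cand w χ) n
      ... | yes eq = eq
      ... | no neq = ⊥-elim (true≢false (refuted {pair w′ n′} (hd-pair w′ n′) (tl-pair w′ n′)) (locked (pair w′ n′)))
        where
        ≡ᵇ-false : ∀ {x y} → ¬ x ≡ y → (x ≡ᵇ y) ≡ false
        ≡ᵇ-false {x} {y} neq with x ≡ᵇ y in e
        ... | false = refl
        ... | true  = ⊥-elim (neq (≡ᵇ-true⁻¹ {x} e))
        refuted : ∀ {k} → hd k ≡ w′ → tl k ≡ n′ → refutes w n k ≡ true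
        refuted eq₁ eq₂ rewrite eq₁ | eq₂ = ∧-true (<ᵇ-true (s≤s n≤n′)) (∧-true
          (all<-true n λ i lt → trans (cong (λ s → encSym s ≡ᵇ encSym (cand w χ i)) (agree i lt))
            (≡ᵇ-true (encSym (cand w χ i))))
          (cong not (≡ᵇ-false neq)))

      next-< : ∀ k w n r → n < proj₂ (next k w n r)
      next-< k w n (inj₁ (l , _)) = ≤-trans (s≤s (≤-trans (m≤n+m n (tl l)) (m≤m+n _ _)))
        (≤-reflexive (sym (+-suc (tl l + n) (pair k (hd (hd l))))))
      next-< k w n (inj₂ _) = ≤-trans (s≤s (m≤m+n n _)) (≤-reflexive (sym (+-suc n _)))

      next-covers : ∀ k w n r → pair k (hd (proj₁ (next k w n r))) < proj₂ (next k w n r)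
      next-covers k w n (inj₁ (l , _)) = m≤n+m _ (tl l + n)
      next-covers k w n (inj₂ _)       = m≤n+m _ n

      next-agree : ∀ k w n r i → i < n → cand (proj₁ (next k w n r)) χ i ≡ cand w χ i
      next-agree k w n (inj₁ (l , h)) i lt = proj₁ (proj₂ (refutes-true⁻¹ w n l h)) i lt
      next-agree k w n (inj₂ _)       i lt = refl

      query : ∀ k → Refutable (seqOf k) (lenOf k) ⊎ Locked (seqOf k) (lenOf k)
      query k = lpo (refutes (seqOf k) (lenOf k))

      lenOf-mono : ∀ {j k} → j ≤ k → lenOf j ≤ lenOf k
      lenOf-mono {j} {k} le with m≤n⇒m<n∨m≡n le
      ... | inj₂ refl = ≤-refl
      lenOf-mono {j} {suc k} le | inj₁ (s≤s j≤k) = ≤-trans (lenOf-mono j≤k) (<⇒≤ (next-< k (seqOf k) (lenOf k) (query k)))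

      k≤lenOf : ∀ k → k ≤ lenOf k
      k≤lenOf zero    = z≤n
      k≤lenOf (suc k) = ≤-trans (s≤s (k≤lenOf k)) (next-< k (seqOf k) (lenOf k) (query k))

      states-agree : ∀ {j k} → j ≤ k → ∀ i → i < lenOf j → cand (seqOf k) χ i ≡ cand (seqOf j) χ i
      states-agree {j} {k} le i lt with m≤n⇒m<n∨m≡n le
      ... | inj₂ refl = refl
      states-agree {j} {suc k} le i lt | inj₁ (s≤s j≤k) = trans
        (next-agree k (seqOf k) (lenOf k) (query k) i (<-≤-trans lt (lenOf-mono j≤k)))
        (states-agree j≤k i lt)

      Y : Text
      Y i = cand (seqOf (suc i)) χ i

      Y-agree : ∀ k i → i < lenOf k → Y i ≡ cand (seqOf k) χ i
      Y-agree k i lt with ≤-total (suc i) k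
      ... | inj₁ le = sym (states-agree le i (k≤lenOf (suc i)))
      ... | inj₂ le = states-agree le i lt

      Y-isText : IsText χ Y
      Y-isText = (λ i → cand-sound (seqOf (suc i)) χ i) , λ {x} p → pair x (hd (seqOf (suc x))) ,
        trans (Y-agree (suc x) _ (next-covers x (seqOf x) (lenOf x) (query x)))
              (cand-complete (seqOf (suc x)) χ p ≤-refl)

      -- Ask at the convergence point `N` of `g` on `Y`. A refutation there would be incorporated
      -- into `Y` by the next state, so `g` would take different values on `Y` at `lenOf N` and
      -- `tl l`, both at least `N`.
      locking : Σ ℕ λ w → Σ ℕ λ n → Locked w n
      locking with limit Y Y-isText
      ... | c , N , h with query N in eq
      ...   | inj₂ locked = seqOf N , lenOf N , locked
      ...   | inj₁ (l , r) with refutes-true⁻¹ (seqOf N) (lenOf N) l r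
      ...     | n≤ , agree , differs = ⊥-elim (differs (trans (sym (trans (sym (h (tl l) (≤-trans (k≤lenOf N) n≤))) after))
                  (trans (sym (h (lenOf N) (k≤lenOf N))) (g-cong (lenOf N) (Y-agree N)))))
        where
        after : g Y (tl l) ≡ g (cand (hd l) χ) (tl l)
        after = g-cong (tl l) λ i lt → trans
          (Y-agree (suc N) i (subst (λ q → i < proj₂ (next N (seqOf N) (lenOf N) q)) (sym eq)
            (<-≤-trans lt (≤-trans (m≤m+n (tl l) (lenOf N)) (m≤m+n _ _)))))
          (cong (λ q → cand (proj₁ (next N (seqOf N) (lenOf N) q)) χ i) eq)

      locked⇒stable : EventuallyStable
      locked⇒stable with locking
      ... | w , n , locked = w* , ev-map at (approximates w* n)
        where
        -- The locked prefix has length `n`, which need not be `hd w`, so it is listed afresh.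
        w* = listing (encSym ∘ cand w χ) n
        hd-w* : hd w* ≡ n
        hd-w* = hd-pair n (tabulateℕ (encSym ∘ cand w χ) n)
        at : ∀ t → (∀ i → i < n → cand w* (P t) i ≡ cand w* χ i) → stable w* (P t) t ≡ true
        at t agree = stable-true λ m le _ →
          trans (value m (subst (_≤ m) hd-w* le)) (sym (value (hd w*) (≤-reflexive (sym hd-w*))))
          where
          X = cand w* (P t)
          value : ∀ m → n ≤ m → g X m ≡ g (cand w χ) n
          value m n≤m = trans (g-cong m λ i lt → sym (cand-listing X (λ {x} eq → P-sound t (cand-sound w* (P t) i eq)) lt))
            -- `Locked` speaks of sequences filtered by `χ`, whereas `X` is filtered by `P t`.
            -- Listing the first `m` symbols of `X` translates, for by `P-sound` the filter `χ`
            -- erases none of them.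
            (locked⇒≡ w n locked (listing (encSym ∘ X) m) m n≤m λ i lt → trans
              (cand-listing X (λ eq → P-sound t (cand-sound w* (P t) i eq)) (<-≤-trans lt n≤m))
              (trans (agree i lt) (cand-listing (cand w χ) (cand-sound w χ i) lt)))

    eventually-stable : EventuallyStable
    eventually-stable with finished-or-LPO
    ... | inj₁ finished = finished⇒stable finished
    ... | inj₂ lpo      = Locking.locked⇒stable lpo

    module _ (limit-correct : ∀ X (X-text : IsText χ X) x → φ proj₁ (limit X X-text) ⟨ x ⟩⇓ bit (χ x)) where

      value : ℕ → ℕ
      value w = proj₁ (limit (cand w χ) (cand-isText w χ))

      -- Beyond `m`, looking stable ties the value at `hd w` to the limit on `cand w χ`. Even a
      -- candidate that is rejected later thus contributes a correct index while it is chosen.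
      guess-correct : ∀ w → Eventually λ t → stable w (P t) t ≡ true → g (cand w (P t)) (hd w) ≡ value w
      guess-correct w = ev-map₂ at (approximates w m) (eventually-≥ m)
        where
        lim = limit (cand w χ) (cand-isText w χ)
        m = proj₁ (proj₂ lim) ⊔ hd w
        at : ∀ t → (∀ i → i < m → cand w (P t) i ≡ cand w χ i) → m ≤ t → stable w (P t) t ≡ true →
          g (cand w (P t)) (hd w) ≡ value w
        at t agree m≤t st = trans (sym (stable-true⁻¹ {w} st m (m≤n⊔m _ (hd w)) m≤t))
          (trans (g-cong m agree) (proj₂ (proj₂ lim) m (m≤m⊔n _ (hd w))))

      K : ℕ
      K = proj₁ eventually-stable

      guess∈values : Eventually λ t → Σ ℕ λ w → w < suc K × guess (P t) t ≡ value w
      guess∈values = ev-map₂ at (ev-map₂ (λ _ → _,_) (proj₂ eventually-stable) (eventually-≥ (suc K)))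
        (ev-∀< (suc K) λ w _ → guess-correct w)
        where
        at : ∀ t → stable K (P t) t ≡ true × K < t →
          (∀ w → w < suc K → stable w (P t) t ≡ true → g (cand w (P t)) (hd w) ≡ value w) →
          Σ ℕ λ w → w < suc K × guess (P t) t ≡ value w
        at t (st , K<t) correct = w , s≤s w≤K , correct w (s≤s w≤K) (least-found _ t (≤-<-trans w≤K K<t))
          where
          w = least (λ w → stable w (P t) t) t
          w≤K : w ≤ K
          w≤K = least-min (λ w → stable w (P t) t) t K K<t st

      -- Below `n₀`, all of the finitely many possible guesses are eventually seen to give the right
      -- bits, so the cut-off reaches `n₀` whichever guess is current. Since each guess decides `χ`,
      -- the approximation is correct up to the cut-off.
      output-limit : Eventually λ t → output (P t) t ≡ c₀
      output-limit = ev-map₂ at guess∈values (ev-map₂ (λ _ → _,_) (eventually-≥ n₀) (ev-map₂ (λ _ → _,_)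
        (ev-∀< n₀ λ x _ → P-limit x)
        (ev-∀< (suc K) λ w _ → ev-∀< n₀ λ x _ → evaluates-complete (value w) x (bit (χ x)) (limit-correct _ _ x))))
        where
        at : ∀ t → (Σ ℕ λ w → w < suc K × guess (P t) t ≡ value w) → n₀ ≤ t × (∀ x → x < n₀ → P t x ≡ χ x) ×
          (∀ w → w < suc K → ∀ x → x < n₀ → evaluates t (value w) x (bit (χ x)) ≡ true) → output (P t) t ≡ c₀
        at t (w , w<K , guess≡) (n₀≤t , P≡χ , evals) = trans
          (g-cong m λ i lt → cand-cong 0 (P t) χ i (agree i lt))
          (proj₂ (proj₂ T̂-limit) m n₀≤m)
          where
          m = agreement (P t) t
          fails : ℕ → Bool
          fails i = not (evaluates t (guess (P t) t) i (bit (P t i)))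
          n₀≤m : n₀ ≤ m
          n₀≤m = ≮⇒≥ λ m<n₀ → true≢false (least-found fails t (<-≤-trans m<n₀ n₀≤t))
            (cong not (subst₂ (λ v b → evaluates t v m (bit b) ≡ true) (sym guess≡) (sym (P≡χ m m<n₀)) (evals w w<K m m<n₀)))
          evaluated : ∀ x → x < m → evaluates t (guess (P t) t) x (bit (P t x)) ≡ true
          evaluated x lt with evaluates t (guess (P t) t) x (bit (P t x)) in e
          ... | true  = refl
          ... | false = ⊥-elim (<⇒≱ lt (least-min fails t x (<-≤-trans lt (least-≤ fails t)) (cong not e)))
          -- The canonical text proposes `hd i` at position `i`, and `hd i` is at most `i`, so
          -- agreement below `m` covers its first `m` symbols.
          agree : ∀ i → i < m → P t (pred (rawSymbol 0 i)) ≡ χ (pred (rawSymbol 0 i))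
          agree i lt = bit-injective (⇓-deterministic
            (subst (λ v → φ v ⟨ hd i ⟩⇓ _) guess≡ (evaluates-sound t _ (hd i) _ (evaluated (hd i) (≤-<-trans (hd≤ i) lt))))
            (limit-correct _ _ (hd i)))

-- Computability of codes of prefixes

prefix-cong : ∀ {X Y : Text} n → (∀ i → i < n → X i ≡ Y i) → prefix X n ≡ prefix Y n
prefix-cong zero    h = refl
prefix-cong (suc n) h = cong₂ _∷_ (h 0 (s≤s z≤n)) (prefix-cong n λ i lt → h (suc i) (s≤s lt))

symbolᶜ : ∀ {m} {w D i : Vec ℕ m → ℕ} → Computable w → Computable D → Computable i →
  Computable (λ ρ → symbol (w ρ) (testBit (D ρ)) (i ρ))
symbolᶜ {w = w} {D} {i} cw cD ci = ifᶜ {b = λ ρ → testBit (D ρ) (pred (rawSymbol (w ρ) (i ρ)))}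
  (testBitᶜ cD (predᶜ craw)) craw (constᶜ 0)
  where
  craw : Computable (λ ρ → rawSymbol (w ρ) (i ρ))
  craw = ifᶜ (ci <ᵇᶜ hdᶜ cw) (nthᶜ (tlᶜ cw) ci) (sucᶜ (hdᶜ ci))

opaque
  unfolding cand

  encSym-cand : ∀ w P i → encSym (cand w P i) ≡ symbol w P i
  encSym-cand w P i = encSym-decSym (symbol w P i)

-- A loop can extend a sequence code only at its front, so the symbols are supplied in descending
-- order.
fromEnd : (ℕ → ℕ) → ℕ → ℕ
fromEnd f n = natrec 0 (λ j acc → suc (pair (f (n ∸ suc j)) acc)) n

fromEnd-seqCode : ∀ (X : Text) f n → (∀ i → encSym (X i) ≡ f i) → fromEnd f n ≡ seqCode (prefix X n)
fromEnd-seqCode X f n eq = trans (go n ≤-refl) (cong seqCode (prefix-cong n λ i _ → cong (λ k → X (k + i)) (n∸n≡0 n)))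
  where
  go : ∀ j → j ≤ n → natrec 0 (λ j acc → suc (pair (f (n ∸ suc j)) acc)) j ≡ seqCode (prefix (λ i → X (n ∸ j + i)) j)
  go zero    _  = refl
  go (suc j) le = cong suc (cong₂ pair
    (sym (trans (cong (encSym ∘ X) (+-identityʳ (n ∸ suc j))) (eq (n ∸ suc j))))
    (trans (go j (<⇒≤ le)) (cong seqCode (prefix-cong j λ i _ → cong X
      (trans (cong (_+ i) (+-∸-assoc 1 le)) (sym (+-suc (n ∸ suc j) i)))))))

prefixCodeᶜ : ∀ {m} {w D n : Vec ℕ m → ℕ} → Computable w → Computable D → Computable n →
  Computable (λ ρ → seqCode (prefix (cand (w ρ) (testBit (D ρ))) (n ρ)))
prefixCodeᶜ {w = w} {D} {n} cw cD cn = computable-≗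
  (λ ρ → fromEnd-seqCode _ (symbol (w ρ) (testBit (D ρ))) (n ρ) (encSym-cand (w ρ) (testBit (D ρ))))
  (natrecᶜ {s = λ j acc ρ → suc (pair (symbol (w ρ) (testBit (D ρ)) (n ρ ∸ suc j)) acc)} (constᶜ 0)
    (sucᶜ (pairᶜ (symbolᶜ (wk (wk cw)) (wk (wk cD)) (wk (wk cn) ∸ᶜ sucᶜ v₀)) (wk v₀))) cn)

-- Making the learner total

module Totalisation (h : ℕ) where

  opaque

    -- Values are shifted by one, leaving 0 to report failure.
    found : ℕ → ℕ → ℕ
    found s c = if y <ᵇ s then suc y else 0
      where
      y : ℕ
      y = least (λ y → evaluates s h c y) s

    _or_ : ℕ → ℕ → ℕ
    v or r = if v ≡ᵇ 0 then r else v

    latest : Text → ℕ → ℕ → ℕ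
    latest X s = natrec (found s (seqCode (prefix X 0))) λ j r → found s (seqCode (prefix X (suc j))) or r

    -- pred turns "nothing found" into the hypothesis 0, an index of the empty set.
    g : Text → ℕ → ℕ
    g X n = pred (latest X n n)

    found-sound : ∀ s c {y} → found s c ≡ suc y → φ h ⟨ c ⟩⇓ y
    found-sound s c eq with least (λ y → evaluates s h c y) s <ᵇ s in lt
    found-sound s c refl | true =
      evaluates-sound s h c _ (least-found (λ y → evaluates s h c y) s (<ᵇ-true⁻¹ lt))

    found-complete : ∀ s c y → y < s → evaluates s h c y ≡ true → found s c ≡ suc y
    found-complete s c y lt ev
      rewrite <ᵇ-true (≤-<-trans (least-min (λ y → evaluates s h c y) s y lt ev) lt) =
      cong suc (⇓-deterministic
        (evaluates-sound s h c _ (least-found (λ y → evaluates s h c y) s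
          (≤-<-trans (least-min (λ y → evaluates s h c y) s y lt ev) lt)))
        (evaluates-sound s h c y ev))

    latest-sound : ∀ X s j {y} → latest X s j ≡ suc y → Σ ℕ λ i → φ h ⟨ seqCode (prefix X i) ⟩⇓ y
    latest-sound X s zero eq = 0 , found-sound s _ eq
    latest-sound X s (suc j) eq with found s (seqCode (prefix X (suc j))) in e
    ... | zero  = latest-sound X s j eq
    ... | suc v = suc j , found-sound s _ (trans e eq)

    g-sound : ∀ X n → g X n ≡ 0 ⊎ Σ ℕ λ i → φ h ⟨ seqCode (prefix X i) ⟩⇓ g X n
    g-sound X n with latest X n n in eq
    ... | zero  = inj₁ refl
    ... | suc y = inj₂ (latest-sound X n n eq)

    latest-cong : ∀ {X Y} s j → (∀ i → i < j → X i ≡ Y i) → latest X s j ≡ latest Y s j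
    latest-cong s zero    eq = refl
    latest-cong s (suc j) eq = cong₂ _or_ (cong (found s ∘ seqCode) (prefix-cong (suc j) eq))
      (latest-cong s j (λ i lt → eq i (m<n⇒m<1+n lt)))

    g-cong : ∀ {X Y} n → (∀ i → i < n → X i ≡ Y i) → g X n ≡ g Y n
    g-cong n eq = cong pred (latest-cong n n eq)

    -- Once the computation on the prefix of length `n₀` is visible, the longest prefix with a
    -- visible value is at least that long, and all of these give `c`.
    g-limit : ∀ X n₀ c → (∀ n → n₀ ≤ n → φ h ⟨ seqCode (prefix X n) ⟩⇓ c) → Eventually λ n → g X n ≡ c
    g-limit X n₀ c conv = ev-map₂ at (eventually-≥ (n₀ ⊔ suc c))
      (evaluates-complete h (seqCode (prefix X n₀)) c (conv n₀ ≤-refl))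
      where
      -- `found` looks only for values below its step bound, so the bound must also exceed `c`.
      at : ∀ n → n₀ ⊔ suc c ≤ n → evaluates n h (seqCode (prefix X n₀)) c ≡ true → g X n ≡ c
      at n le ev = cong pred (settled n (≤-trans (m≤m⊔n n₀ (suc c)) le))
        where
        start : found n (seqCode (prefix X n₀)) ≡ suc c
        start = found-complete n _ c (≤-trans (m≤n⊔m n₀ (suc c)) le) ev
        settled : ∀ j → n₀ ≤ j → latest X n j ≡ suc c
        settled zero    z≤n = start
        settled (suc j) n₀≤ with found n (seqCode (prefix X (suc j))) in e
        ... | suc y = cong suc (⇓-deterministic (found-sound n _ e) (conv (suc j) n₀≤))
        ... | zero with m≤n⇒m<n∨m≡n n₀≤
        ...   | inj₁ (s≤s lt) = settled j lt
        ...   | inj₂ refl with () ← trans (sym start) e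

  open Learner g g-cong public

  opaque
    unfolding g

    foundᶜ : Computable₂ found
    foundᶜ {a = s} {c} cs cc = ifᶜ (cy <ᵇᶜ cs) (sucᶜ cy) (constᶜ 0)
      where
      cy : Computable (λ ρ → least (λ y → evaluates (s ρ) h (c ρ) y) (s ρ))
      cy = leastᶜ {P = λ y ρ → evaluates (s ρ) h (c ρ) y} (evaluatesᶜ (wk cs) (constᶜ h) (wk cc) v₀) cs

    gᶜ : ∀ {m} {w D n : Vec ℕ m → ℕ} → Computable w → Computable D → Computable n →
      Computable (λ ρ → g (cand (w ρ) (testBit (D ρ))) (n ρ))
    gᶜ {m} {w} {D} {n} cw cD cn = predᶜ (natrecᶜ {s = λ j r ρ → value j ρ or r}
      (foundᶜ cn (prefixCodeᶜ cw cD (constᶜ 0)))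
      (ifᶜ (cvalue ≡ᵇᶜ constᶜ 0) (wk v₀) cvalue) cn)
      where
      value : ℕ → Vec ℕ m → ℕ
      value j ρ = found (n ρ) (seqCode (prefix (cand (w ρ) (testBit (D ρ))) (suc j)))
      cvalue : Computable (λ ρ → value (head ρ) (tail (tail ρ)))
      cvalue = foundᶜ (wk (wk cn)) (prefixCodeᶜ (wk (wk cw)) (wk (wk cD)) (sucᶜ v₀))

  stableᶜ : ∀ {m} {w D t : Vec ℕ m → ℕ} → Computable w → Computable D → Computable t →
    Computableᵇ (λ ρ → stable (w ρ) (testBit (D ρ)) (t ρ))
  stableᶜ {w = w} {D} {t} cw cD ct = all<ᶜ
    {P = λ n ρ → (n <ᵇ hd (w ρ)) ∨ (g (cand (w ρ) (testBit (D ρ))) n ≡ᵇ g (cand (w ρ) (testBit (D ρ))) (hd (w ρ)))}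
    (sucᶜ ct)
    ((v₀ <ᵇᶜ hdᶜ (wk cw)) ∨ᶜ (gᶜ (wk cw) (wk cD) v₀ ≡ᵇᶜ gᶜ (wk cw) (wk cD) (hdᶜ (wk cw))))

  guessᶜ : ∀ {m} {D t : Vec ℕ m → ℕ} → Computable D → Computable t →
    Computable (λ ρ → guess (testBit (D ρ)) (t ρ))
  guessᶜ {D = D} {t} cD ct = gᶜ cw cD (hdᶜ cw)
    where
    cw : Computable (λ ρ → least (λ w → stable w (testBit (D ρ)) (t ρ)) (t ρ))
    cw = leastᶜ {P = λ w ρ → stable w (testBit (D ρ)) (t ρ)} (stableᶜ v₀ (wk cD) (wk ct)) ct

  outputᶜ : ∀ {m} {D t : Vec ℕ m → ℕ} → Computable D → Computable t →
    Computable (λ ρ → output (testBit (D ρ)) (t ρ))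
  outputᶜ {D = D} {t} cD ct = gᶜ (constᶜ 0) cD
    (leastᶜ {P = λ i ρ → not (evaluates (t ρ) (guess (testBit (D ρ)) (t ρ)) i (bit (testBit (D ρ) i)))}
      (notᶜ (evaluatesᶜ (wk ct) (guessᶜ (wk cD) (wk ct)) v₀ (testBitᶜ (wk cD) v₀))) ct)

  opaque

    outputᶜ′ : Computable {1} (λ ρ → output (testBit (hd (head ρ))) (tl (head ρ)))
    outputᶜ′ = outputᶜ (hdᶜ v₀) (tlᶜ v₀)

  learner : ℕ
  learner = encode (code outputᶜ′)

  learner-⇓ : ∀ z → φ learner ⟨ z ⟩⇓ output (testBit (hd z)) (tl z)
  learner-⇓ z = subst (_⊢ z ∷ [] ⇓ output (testBit (hd z)) (tl z)) (sym (program-encode (code outputᶜ′))) (eval outputᶜ′ (z ∷ []))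

  hypothesis : Text → ℕ → ℕ
  hypothesis T t = output (testBit (contentCode T t)) t

  learner-Psd : ∀ T t → Psd learner T t (hypothesis T t)
  learner-Psd T t = subst₂ (λ D s → φ learner ⟨ pair (contentCode T t) t ⟩⇓ output (testBit D) s)
    (hd-pair (contentCode T t) t) (tl-pair (contentCode T t) t) (learner-⇓ (pair (contentCode T t) t))

-- The two inclusions

append : Text → ℕ → Text → Text
append X n T i = if i <ᵇ n then X i else T (i ∸ n)

prefix-append : ∀ X n T → prefix (append X n T) n ≡ prefix X n
prefix-append X n T = prefix-cong n λ i lt → cong (λ b → if b then X i else T (i ∸ n)) (<ᵇ-true lt)

content-append : ∀ X n T → (∀ i {x} → X i ≡ just x → content T x) → ∀ x → content (append X n T) x ⇔ content T x
content-append X n T sub x = mk⇔ forward backward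
  where
  forward : content (append X n T) x → content T x
  forward (i , eq) with i <ᵇ n
  ... | true  = sub i eq
  ... | false = i ∸ n , eq
  backward : content T x → content (append X n T) x
  backward (i , eq) = n + i , trans
    (cong (λ b → if b then X (n + i) else T (n + i ∸ n)) (<ᵇ-false (m≤m+n n i)))
    (trans (cong T (m+n∸m≡n n i)) eq)

CIndex-0 : CIndex 0
CIndex-0 x = inj₁ ev-zer

module _ (h : ℕ) where
  open Totalisation h

  -- Unless it is the default 0, the hypothesis is one that h conjectures on
  -- some text with the same content.
  hypothesis-CIndex : ∀ T t → (∀ T′ → (∀ x → content T′ x ⇔ content T x) → ⟦ CInd ⟧ (G h T′) T′) →
    CIndex (hypothesis T t)
  hypothesis-CIndex T t cind = go (g-sound X (agreement P t))
    where
    P = testBit (contentCode T t)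
    X = cand 0 P
    go : g X (agreement P t) ≡ 0 ⊎ (Σ ℕ λ i → φ h ⟨ seqCode (prefix X i) ⟩⇓ g X (agreement P t)) →
      CIndex (hypothesis T t)
    go (inj₁ eq) = subst CIndex (sym eq) CIndex-0
    go (inj₂ (i , d))
      with cind (append X i T) (content-append X i T λ j eq → contentCode-sound T t _ (cand-sound 0 P j eq)) i
    ... | c , d′ , index = subst CIndex
      (⇓-deterministic (subst (λ σ → φ h ⟨ seqCode σ ⟩⇓ c) (prefix-append X i T) d′) d) index

  -- Restricting the premise to texts with the content of `T` serves both uses: for `δ` every text
  -- qualifies, for `δ′` these are texts for the same language.
  learner-restriction : ∀ δ T → (∀ T′ → (∀ x → content T′ x ⇔ content T x) → ⟦ δ ⟧ (G h T′) T′) →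
    ⟦ δ ⟧ (Psd learner T) T
  learner-restriction Tr   T _    = tt
  learner-restriction CInd T cind = λ i → hypothesis T i , learner-Psd T i , hypothesis-CIndex T i cind

  module _ {L : Pred ℕ 0ℓ} (rec : REC L) (learns : ∀ T → TextFor T L → ExC (G h T) T) where

    χ : ℕ → Bool
    χ x with proj₁ (proj₂ rec) x
    ... | inj₁ _ = false
    ... | inj₂ _ = true

    χ-sound : ∀ {x} → χ x ≡ true → L x
    χ-sound {x} eq with proj₁ (proj₂ rec) x
    ... | inj₂ d = to (proj₂ (proj₂ rec) x) d

    χ-complete : ∀ {x} → L x → χ x ≡ true
    χ-complete {x} l with proj₁ (proj₂ rec) x
    ... | inj₂ _ = refl
    ... | inj₁ d with () ← ⇓-deterministic d (from (proj₂ (proj₂ rec) x) l)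

    textFor : ∀ X → IsText χ X → TextFor X L
    textFor X (sound , complete) x = mk⇔ (λ (i , eq) → χ-sound (sound i eq)) (complete ∘ χ-complete)

    limit : ∀ X → IsText χ X → Σ ℕ λ c → Eventually λ n → g X n ≡ c
    limit X X-text with learns X (textFor X X-text)
    ... | n₀ , c , conv , _ = c , g-limit X n₀ c conv

    limit-index : ∀ X (X-text : IsText χ X) → CIndex (proj₁ (limit X X-text)) ×
      (∀ x → C (proj₁ (limit X X-text)) x ⇔ content X x)
    limit-index X X-text with learns X (textFor X X-text)
    ... | _ , _ , _ , index = index

    limit-correct : ∀ X (X-text : IsText χ X) x → φ proj₁ (limit X X-text) ⟨ x ⟩⇓ bit (χ x)
    limit-correct X X-text x with proj₁ (limit-index X X-text) x | χ x in eq
    ... | inj₁ d | false = d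
    ... | inj₂ d | true  = d
    ... | inj₁ _ | true  = from (proj₂ (limit-index X X-text) x) (proj₂ X-text eq)
    ... | inj₂ d | false =
      ⊥-elim (true≢false (proj₁ X-text _ (proj₂ (to (proj₂ (limit-index X X-text) x) d))) eq)

    learner-ExC : ∀ T → TextFor T L → ExC (Psd learner T) T
    learner-ExC T T-text = proj₁ converges , _ ,
      (λ t le → subst (Psd learner T t) (proj₂ converges t le) (learner-Psd T t)) ,
      proj₁ index , λ x → mk⇔
        (λ d → from (T-text x) (to (textFor _ (cand-isText 0 χ) x) (to (proj₂ index x) d)))
        (λ c → from (proj₂ index x) (from (textFor _ (cand-isText 0 χ) x) (to (T-text x) c)))
      where
      P : ℕ → ℕ → Bool
      P t = testBit (contentCode T t)
      P-sound : ∀ t {x} → P t x ≡ true → χ x ≡ true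
      P-sound t {x} p = χ-complete (to (T-text x) (contentCode-sound T t x p))
      P-limit : ∀ x → Eventually λ t → P t x ≡ χ x
      P-limit x with χ x in eq
      ... | true with from (T-text x) (χ-sound eq)
      ...   | i , T-i = suc i , λ t lt → contentCode-complete T t i x lt T-i
      P-limit x | false = always λ t → go t
        where
        go : ∀ t → P t x ≡ false
        go t with P t x in p
        ... | false = refl
        ... | true  = ⊥-elim (true≢false (P-sound t p) eq)
      converges = Convergence.output-limit χ P P-sound P-limit limit limit-correct
      index = limit-index (cand 0 χ) (cand-isText 0 χ)

textFor-content : ∀ {T T′ : Text} {L : Pred ℕ 0ℓ} → (∀ x → content T′ x ⇔ content T x) → TextFor T L → TextFor T′ L
textFor-content same T-text x =
  mk⇔ (to (T-text x) ∘ to (same x)) (from (same x) ∘ from (T-text x))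

G⇒Psd : ∀ δ δ′ 𝓛 → (∀ L → 𝓛 L → REC L) → LearnG δ δ′ 𝓛 → LearnRPsd δ δ′ 𝓛
G⇒Psd δ δ′ 𝓛 rec (h , all-texts , learns) =
  Totalisation.learner h ,
  (λ z → _ , Totalisation.learner-⇓ h z) ,
  (λ T → learner-restriction h δ T λ T′ _ → all-texts T′) ,
  λ L L∈𝓛 T T-text →
    learner-restriction h δ′ T (λ T′ same → proj₁ (learns L L∈𝓛 T′ (textFor-content {T} {T′} same T-text))) ,
    learner-ExC h (rec L L∈𝓛) (λ T T-text → proj₂ (learns L L∈𝓛 T T-text)) T T-text

-- Content and length from the code of a sequence

foldCode : (ℕ → ℕ → ℕ) → ℕ → ℕ → ℕ
foldCode f zero    c = 0
foldCode f (suc n) c = f c (foldCode f n (tl (pred c)))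

drop : ℕ → ℕ → ℕ
drop c = natrec c λ _ r → tl (pred r)

foldCodeᶜ : ∀ {f} → Computable₂ f → Computable₂ (foldCode f)
foldCodeᶜ {f} cf {a = n} {b = c} cn cc = computable-≗ (λ ρ → lemma (c ρ) (n ρ))
  (natrecᶜ {s = λ j acc ρ → f (drop (c ρ) (n ρ ∸ suc j)) acc} (constᶜ 0)
    (cf (natrecᶜ {s = λ _ r _ → tl (pred r)} (wk (wk cc)) (tlᶜ (predᶜ (wk v₀))) (wk (wk cn) ∸ᶜ sucᶜ v₀)) (wk v₀)) cn)
  where
  lemma : ∀ c n → natrec 0 (λ j acc → f (drop c (n ∸ suc j)) acc) n ≡ foldCode f n c
  lemma c n = trans (go n ≤-refl) (cong (λ k → foldCode f n (drop c k)) (n∸n≡0 n))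
    where
    go : ∀ j → j ≤ n → natrec 0 (λ j acc → f (drop c (n ∸ suc j)) acc) j ≡ foldCode f j (drop c (n ∸ j))
    go zero    _  = refl
    go (suc j) le = cong (f (drop c (n ∸ suc j)))
      (trans (go j (<⇒≤ le)) (cong (λ k → foldCode f j (drop c k)) (+-∸-assoc 1 le)))

-- Past the end the remaining code stays 0, and `f 0 0 ≡ 0` makes surplus fuel harmless. Hence the
-- code itself, which bounds the length, can serve as fuel.
foldCode-seqCode : ∀ f (F : List (Maybe ℕ) → ℕ) → f 0 0 ≡ 0 → F [] ≡ 0 →
  (∀ s σ → f (suc (pair (encSym s) (seqCode σ))) (F σ) ≡ F (s ∷ σ)) →
  ∀ n σ → length σ ≤ n → foldCode f n (seqCode σ) ≡ F σ
foldCode-seqCode f F f0 F[] F∷ zero [] _ = sym F[]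
foldCode-seqCode f F f0 F[] F∷ (suc n) [] _ =
  trans (cong (f 0) (trans (foldCode-seqCode f F f0 F[] F∷ n [] z≤n) F[])) (trans f0 (sym F[]))
foldCode-seqCode f F f0 F[] F∷ (suc n) (s ∷ σ) (s≤s le) = trans
  (cong (f (seqCode (s ∷ σ))) (trans (cong (foldCode f n) (tl-pair (encSym s) (seqCode σ)))
    (foldCode-seqCode f F f0 F[] F∷ n σ le)))
  (F∷ s σ)

length≤seqCode : ∀ σ → length σ ≤ seqCode σ
length≤seqCode []      = z≤n
length≤seqCode (s ∷ σ) = s≤s (≤-trans (length≤seqCode σ) (y≤pair (encSym s) (seqCode σ)))

-- For the content, a pause and a position past the end are alike; for the length they differ, so
-- `countHead` tests the code itself instead of its first symbol.
insertHead countHead : ℕ → ℕ → ℕ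
insertHead c acc = if hd (pred c) ≡ᵇ 0 then acc else insertSet (pred (hd (pred c))) acc
countHead c acc = if c ≡ᵇ 0 then acc else suc acc

insertHead-seqCode : ∀ σ n → length σ ≤ n → foldCode insertHead n (seqCode σ) ≡ setCode (catMaybes σ)
insertHead-seqCode σ n le = foldCode-seqCode insertHead (setCode ∘ catMaybes) refl refl cons n σ le
  where
  cons : ∀ s σ → insertHead (suc (pair (encSym s) (seqCode σ))) (setCode (catMaybes σ)) ≡ setCode (catMaybes (s ∷ σ))
  cons nothing  σ rewrite hd-pair 0 (seqCode σ) = refl
  cons (just x) σ rewrite hd-pair (suc x) (seqCode σ) = refl

countHead-seqCode : ∀ σ n → length σ ≤ n → foldCode countHead n (seqCode σ) ≡ length σ
countHead-seqCode σ n le = foldCode-seqCode countHead length refl refl (λ _ _ → refl) n σ le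

contentAndLength : ℕ → ℕ
contentAndLength c = pair (foldCode insertHead c c) (foldCode countHead c c)

contentAndLength-prefix : ∀ T i → contentAndLength (seqCode (prefix T i)) ≡ pair (contentCode T i) i
contentAndLength-prefix T i = cong₂ pair
  (insertHead-seqCode (prefix T i) _ (length≤seqCode (prefix T i)))
  (trans (countHead-seqCode (prefix T i) _ (length≤seqCode (prefix T i))) (length-applyUpTo T i))

opaque

  contentAndLengthᶜ : Computable {1} (λ ρ → contentAndLength (head ρ))
  contentAndLengthᶜ = pairᶜ
    (foldCodeᶜ {insertHead} (λ cc cacc → ifᶜ (hdᶜ (predᶜ cc) ≡ᵇᶜ constᶜ 0) cacc
      (insertSetᶜ (predᶜ (hdᶜ (predᶜ cc))) cacc)) v₀ v₀)
    (foldCodeᶜ {countHead} (λ cc cacc → ifᶜ (cc ≡ᵇᶜ constᶜ 0) cacc (sucᶜ cacc)) v₀ v₀)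

module _ (h : ℕ) where

  fromPsd : ℕ
  fromPsd = encode (comp (program h) (code contentAndLengthᶜ ∷ []))

  Psd⇒G-⇓ : ∀ T i y → Psd h T i y → G fromPsd T i y
  Psd⇒G-⇓ T i y d = subst (_⊢ seqCode (prefix T i) ∷ [] ⇓ y)
    (sym (program-encode (comp (program h) (code contentAndLengthᶜ ∷ []))))
    (ev-comp (ev-∷ (eval contentAndLengthᶜ (seqCode (prefix T i) ∷ [])) ev-[])
      (subst (λ z → φ h ⟨ z ⟩⇓ y) (sym (contentAndLength-prefix T i)) d))

⟦⟧-mono : ∀ δ {p q : HypSeq} T → (∀ i y → p i y → q i y) → ⟦ δ ⟧ p T → ⟦ δ ⟧ q T
⟦⟧-mono CInd T sub cind i with cind i
... | c , p , index = c , sub i c p , index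
⟦⟧-mono Tr T sub _ = tt

Psd⇒G : ∀ δ δ′ 𝓛 → LearnRPsd δ δ′ 𝓛 → LearnG δ δ′ 𝓛
Psd⇒G δ δ′ 𝓛 (h , _ , all-texts , learns) = fromPsd h ,
  (λ T → ⟦⟧-mono δ T (Psd⇒G-⇓ h T) (all-texts T)) ,
  λ L L∈𝓛 T T-text → ⟦⟧-mono δ′ T (Psd⇒G-⇓ h T) (proj₁ (learns L L∈𝓛 T T-text)) ,
    exC T (proj₂ (learns L L∈𝓛 T T-text))
  where
  exC : ∀ T → ExC (Psd h T) T → ExC (G (fromPsd h) T) T
  exC T (n₀ , c , conv , index) = n₀ , c , (λ n le → Psd⇒G-⇓ h T n c (conv n le)) , index

theorem3 : (δ δ′ : Restr) (𝓛 : Pred (Pred ℕ 0ℓ) 0ℓ) →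
    (∀ L → 𝓛 L → REC L) →
    LearnG δ δ′ 𝓛 ⇔ LearnRPsd δ δ′ 𝓛
theorem3 δ δ′ 𝓛 rec = mk⇔ (G⇒Psd δ δ′ 𝓛 rec) (Psd⇒G δ δ′ 𝓛)
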